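{- Let $t\geq 5$ be an integer and let $G_t$ be any graph constructed as described in the context. Then for every edge $e\in E(G_t)$, the graph $G_t-e$ has an induced subgraph isomorphic to the cycle on $2t-2$ vertices.
   Context: Graphs are finite and simple; path length = number of edges. Territories. A territory is a pair $(T,B)$ where $T$ is a graph and $B$ an induced cycle in $T$; its perimeter is the length of $B$. Expansion (w.r.t. $t$): given a territory $(T',B')$, choose for some $k\geq0$ a stable set $\{x_1,\dots,x_k\}$ of $B'$, let $x_i^-,x_i^+$ be the neighbours of $x_i$ in $B'$, and choose $I\subseteq\{1,\dots,k\}$. Build $T$ from $T'$: for each $i$ add a new path $P_i$ of length $2t-6$ with ends $y_i^-,y_i^+$ and middle vertex $y_i$, and edges $x_i^-y_i^-,x_iy_i,x_i^+y_i^+$; for each $i\in I$, with $v_i^-,v_i^+$ the neighbours of $y_i$ in $P_i$ ($v_i^-$ on the side of $y_i^-$), add a new path $Q_i$ of length $t-4$ with ends $z_i^-,z_i^+$ and edges $v_i^-z_i^-,v_i^+z_i^+$ (all new vertices distinct). For $i\notin I$, $R_i=x_i^-\text{ - }y_i^-\text{ - }P_i\text{ - }y_i^+\text{ - }x_i^+$; for $i\in I$, $R_i$ goes $x_i^-,y_i^-$, along $P_i$ to $v_i^-$, $z_i^-$, along $Q_i$ to $z_i^+$, $v_i^+$, along $P_i$ to $y_i^+$, $x_i^+$. Set $B=(B'\setminus\{x_1,\dots,x_k\})\cup\bigcup_iR_i$; $(T,B)$ is an expansion of $(T',B')$. The territories $(T_m,B_m)$: $T_0=B_0$ is a $t$-cycle;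 for $m\ge1$, with $N=t(t-3)^{m-1}$ and $B_{m-1}=x_1\text{ - }\cdots\text{ - }x_N\text{ - }x_1$, $T_m$ is obtained from $T_{m-1}$ by adding a new cycle $B_m$, the $(t-4)$-subdivision of an $N$-cycle $x_1'\text{ - }\cdots\text{ - }x_N'\text{ - }x_1'$ (each edge replaced by a path of length $t-3$), and the edges $x_ix_i'$. A territory $(T,B)$ is canonical if for some $m\ge0$ there is an expansion $(T',B')$ of $(T_m,B_m)$ and an isomorphism $T\to T'$ mapping $B$ isomorphically onto $B'$. Construction. Let $g=t^{5t}$ and let $\Gamma$ be a $3$-regular graph of girth at least $g$ with a Hamiltonian cycle $\Omega$. Let $(M_1,M_2)$ be a partition of $E(\Omega)$ into two perfect matchings of $\Gamma$ and $M_3=E(\Gamma)\setminus E(\Omega)$. For $i\in\{1,2,3\}$ let $\mathcal{K}_i$ be the set of components (cycles) of the spanning subgraph of $\Gamma$ with edge set $E(\Gamma)\setminus M_i$, and $\mathcal{K}=\mathcal{K}_1\cup\mathcal{K}_2\cup\mathcal{K}_3$. For each $K\in\mathcal{K}$ let $T_K$ be a graph such that $(T_K,K)$ is a canonical territory (of perimeter equal to the length of $K$), with $V(T_K)\cap V(\Gamma)=V(K)$, and such that $V(T_K)\cap V(T_{K'})=V(K)\cap V(K')$ for all distinct $K,K'\in\mathcal{K}$. Define $G_t=\Gamma\cup\bigcup_{K\in\mathcal{K}}T_K$ (union of vertex sets and of edge sets). -}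

module Defs where

open import Data.Nat using (ℕ; zero; suc; _+_; _*_; _∸_; _^_; _≤_)
open import Data.Fin using (Fin; toℕ)
open import Data.Fin.Subset using (Subset; _∈_)
open import Data.Bool using (Bool; true; false; T)
open import Data.Sum using (_⊎_; inj₁; inj₂)
open import Data.Product using (Σ; _×_; _,_; proj₁; proj₂)
open import Data.Empty using (⊥)
open import Data.Unit using (⊤)
open import Relation.Nullary using (¬_)
open import Relation.Binary.PropositionalEquality using (_≡_; _≢_)
open import Relation.Binary.Construct.Closure.ReflexiveTransitive using (Star)
open import Function using (id)
open import Function.Bundles using (_↔_; _⇔_; Inverse)
open import Function.Definitions using (Injective)

record Graph : Set₁ where
  field
    V : Set
    E : V → V → Set
open Graph public

Rel : Set → Set₁
Rel A = A → A → Set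

IsSimple : {A : Set} → Rel A → Set
IsSimple {A} R = (∀ {x y : A} → R x y → R y x) × (∀ {x : A} → ¬ R x x)

Next : (p : ℕ) → Fin p → Fin p → Set
Next p i j = (suc (toℕ i) ≡ toℕ j) ⊎ ((suc (toℕ i) ≡ p) × (toℕ j ≡ 0))

CycAdj : (p : ℕ) → Fin p → Fin p → Set
CycAdj p i j = Next p i j ⊎ Next p j i

PathAdj : {k : ℕ} → Fin k → Fin k → Set
PathAdj i j = (suc (toℕ i) ≡ toℕ j) ⊎ (suc (toℕ j) ≡ toℕ i)

HasInducedCycle : {A : Set} → Rel A → ℕ → Set
HasInducedCycle {A} R p =
  Σ (Fin p → A) λ f → Injective _≡_ _≡_ f × (∀ i j → R (f i) (f j) ⇔ CycAdj p i j)

DeleteEdge : {A : Set} → Rel A → A → A → Rel A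
DeleteEdge R u v x y = R x y × ¬ (((x ≡ u) × (y ≡ v)) ⊎ ((x ≡ v) × (y ≡ u)))

-- Ordered territories: a graph with its boundary cycle listed in cyclic order.

record OTerr : Set₁ where
  field
    OV  : Set
    OE  : OV → OV → Set
    len : ℕ
    bd  : Fin len → OV
open OTerr public

module _ (t : ℕ) where

  Tm : ℕ → OTerr
  Tm zero = record { OV = Fin t ; OE = CycAdj t ; len = t ; bd = id }
  Tm (suc m) = record { OV = OV O ⊎ Fin L ; OE = adj ; len = L ; bd = inj₂ }
    where
      O : OTerr
      O = Tm m
      L : ℕ
      L = len O * (t ∸ 3)
      Link : OV O → Fin L → Set
      Link u r = Σ (Fin (len O)) λ j → (u ≡ bd O j) × (toℕ r ≡ toℕ j * (t ∸ 3))
      adj : OV O ⊎ Fin L → OV O ⊎ Fin L → Set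
      adj (inj₁ u) (inj₁ v) = OE O u v
      adj (inj₂ q) (inj₂ r) = CycAdj L q r
      adj (inj₁ u) (inj₂ r) = Link u r
      adj (inj₂ q) (inj₁ v) = Link v q

record ExpData (t : ℕ) (O : OTerr) : Set where
  field
    X      : Fin (len O) → Bool
    I      : Fin (len O) → Bool
    stable : ∀ i j → CycAdj (len O) i j → T (X i) → T (X j) → ⊥
    I⊆X    : ∀ i → T (I i) → T (X i)

module Expansion (t : ℕ) (O : OTerr) (d : ExpData t O) where
  open ExpData d
  p : ℕ
  p = len O
  b : Fin p → OV O
  b = bd O

  -- P_i has 2t-5 vertices 0 .. 2t-6 (y^- = 0, y = t-3, y^+ = 2t-6)
  PV : Set
  PV = Σ (Fin p) (λ i → T (X i)) × Fin (2 * t ∸ 5)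
  -- Q_i has t-3 vertices 0 .. t-4 (z^- = 0, z^+ = t-4)
  QV : Set
  QV = Σ (Fin p) (λ i → T (I i)) × Fin (t ∸ 3)

  EV : Set
  EV = OV O ⊎ (PV ⊎ QV)

  D : EV → EV → Set
  D (inj₁ u) (inj₁ v) = OE O u v
  D (inj₁ u) (inj₂ (inj₁ ((i , _) , q))) =
      (Σ (Fin p) λ j → Next p j i × (u ≡ b j) × (toℕ q ≡ 0))          -- x_i^- y_i^-
    ⊎ ((u ≡ b i) × (toℕ q ≡ t ∸ 3))                                    -- x_i y_i
    ⊎ (Σ (Fin p) λ j → Next p i j × (u ≡ b j) × (toℕ q ≡ 2 * t ∸ 6))  -- x_i^+ y_i^+
  D (inj₂ (inj₁ ((i , _) , q))) (inj₂ (inj₁ ((i' , _) , q'))) =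
    (i ≡ i') × (suc (toℕ q) ≡ toℕ q')
  D (inj₂ (inj₂ ((i , _) , r))) (inj₂ (inj₂ ((i' , _) , r'))) =
    (i ≡ i') × (suc (toℕ r) ≡ toℕ r')
  D (inj₂ (inj₁ ((i , _) , q))) (inj₂ (inj₂ ((i' , _) , r))) =
    (i ≡ i') × (((toℕ q ≡ t ∸ 4) × (toℕ r ≡ 0))                        -- v_i^- z_i^-
               ⊎ ((toℕ q ≡ t ∸ 2) × (toℕ r ≡ t ∸ 4)))                  -- v_i^+ z_i^+
  D _ _ = ⊥

  EE : EV → EV → Set
  EE x y = D x y ⊎ D y x

  -- the new boundary B = (B' \ {x_i}) ∪ ⋃ R_i
  inB : EV → Set
  inB (inj₁ u) = Σ (Fin p) λ j → (u ≡ b j) × ¬ T (X j)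
  inB (inj₂ (inj₁ ((i , _) , q))) = ¬ (T (I i) × (toℕ q ≡ t ∸ 3))
  inB (inj₂ (inj₂ _)) = ⊤

Canonical : (t : ℕ) (Tg : Graph) → (V Tg → Set) → Set
Canonical t Tg Bset =
  Σ ℕ λ m → Σ (ExpData t (Tm t m)) λ d →
    let open Expansion t (Tm t m) d in
    Σ (V Tg ↔ EV) λ φ →
      (∀ a a' → E Tg a a' ⇔ EE (Inverse.to φ a) (Inverse.to φ a'))
      × (∀ a → Bset a ⇔ inB (Inverse.to φ a))

IsCycleIn : {n : ℕ} → Rel (Fin n) → (k : ℕ) → (Fin k → Fin n) → Set
IsCycleIn R k c = (3 ≤ k) × Injective _≡_ _≡_ c × (∀ i j → Next k i j → R (c i) (c j))

IsComponent : {n : ℕ} → Rel (Fin n) → Subset n → Set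
IsComponent {n} R S =
  (Σ (Fin n) λ x → x ∈ S)
  × (∀ x y → x ∈ S → R x y → y ∈ S)
  × (∀ x y → x ∈ S → y ∈ S → Star R x y)

IsPerfectMatching : {n : ℕ} → Rel (Fin n) → Rel (Fin n) → Set
IsPerfectMatching {n} EΓ M =
  (∀ x y → M x y → M y x)
  × (∀ x y → M x y → EΓ x y)
  × (∀ x → Σ (Fin n) λ y → M x y × (∀ y' → M x y' → y' ≡ y))

pick3 : {A : Set₁} → A → A → A → Fin 3 → A
pick3 a b c Fin.zero = a
pick3 a b c (Fin.suc Fin.zero) = b
pick3 a b c (Fin.suc (Fin.suc Fin.zero)) = c

record Construction (t : ℕ) : Set₁ where
  field
    n        : ℕ
    EΓ       : Rel (Fin n)
    simpleΓ  : IsSimple EΓ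
    cubic    : ∀ x → Σ (Fin n) λ a → Σ (Fin n) λ b → Σ (Fin n) λ c →
                 (a ≢ b) × (a ≢ c) × (b ≢ c) ×
                 (∀ y → EΓ x y ⇔ ((y ≡ a) ⊎ (y ≡ b) ⊎ (y ≡ c)))
    girth    : ∀ k (c : Fin k → Fin n) → IsCycleIn EΓ k c → t ^ (5 * t) ≤ k
    ω        : Fin n → Fin n
    hamilton : IsCycleIn EΓ n ω
  EΩ : Rel (Fin n)
  EΩ x y = Σ (Fin n) λ i → Σ (Fin n) λ j → Next n i j ×
             (((x ≡ ω i) × (y ≡ ω j)) ⊎ ((x ≡ ω j) × (y ≡ ω i)))
  field
    M₁ M₂     : Rel (Fin n)
    M₁-pm     : IsPerfectMatching EΓ M₁
    M₂-pm     : IsPerfectMatching EΓ M₂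
    M-cover   : ∀ x y → EΩ x y ⇔ (M₁ x y ⊎ M₂ x y)
    M-disj    : ∀ x y → M₁ x y → M₂ x y → ⊥
  M₃ : Rel (Fin n)
  M₃ x y = EΓ x y × ¬ EΩ x y
  M : Fin 3 → Rel (Fin n)
  M = pick3 M₁ M₂ M₃
  H : Fin 3 → Rel (Fin n)
  H i x y = EΓ x y × ¬ M i x y
  -- 𝒦 : K = (i , S) with S the vertex set of a component of Γ \ M_i
  field
    U        : Set
    ιΓ       : Fin n → U
    ιΓ-inj   : Injective _≡_ _≡_ ιΓ
    TK       : Fin 3 → Subset n → Graph
    ι        : ∀ i S → V (TK i S) → U
    ι-inj    : ∀ i S → Injective _≡_ _≡_ (ι i S)
  inΓ : U → Set
  inΓ u = Σ (Fin n) λ x → ιΓ x ≡ u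
  inTK : Fin 3 → Subset n → U → Set
  inTK i S u = Σ (V (TK i S)) λ a → ι i S a ≡ u
  inK : Subset n → U → Set
  inK S u = Σ (Fin n) λ x → x ∈ S × ιΓ x ≡ u
  onK : ∀ i S → V (TK i S) → Set
  onK i S a = inK S (ι i S a)
  field
    TK∩Γ     : ∀ i S → IsComponent (H i) S →
                 ∀ u → (inTK i S u × inΓ u) ⇔ inK S u
    -- K is the (induced) boundary cycle of T_K: on V(K), T_K has exactly the edges of K
    TK-K     : ∀ i S → IsComponent (H i) S → ∀ a a' x x' →
                 x ∈ S → x' ∈ S → ι i S a ≡ ιΓ x → ι i S a' ≡ ιΓ x' →
                 E (TK i S) a a' ⇔ H i x x'
    TK-canon : ∀ i S → IsComponent (H i) S → Canonical t (TK i S) (onK i S)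
    TK∩TK    : ∀ i S i' S' → IsComponent (H i) S → IsComponent (H i') S' →
                 ¬ ((i ≡ i') × (S ≡ S')) →
                 ∀ u → (inTK i S u × inTK i' S' u) ⇔ (inK S u × inK S' u)
    cover    : ∀ u → inΓ u ⊎ (Σ (Fin 3) λ i → Σ (Subset n) λ S →
                                 IsComponent (H i) S × inTK i S u)

  EG : Rel U
  EG u v = (Σ (Fin n) λ x → Σ (Fin n) λ y → (ιΓ x ≡ u) × (ιΓ y ≡ v) × EΓ x y)
         ⊎ (Σ (Fin 3) λ i → Σ (Subset n) λ S → IsComponent (H i) S ×
              Σ (V (TK i S)) λ a → Σ (V (TK i S)) λ a' →
                (ι i S a ≡ u) × (ι i S a' ≡ v) × E (TK i S) a a')

{-# OPTIONS --safe #-}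
-- Every face of a canonical territory is a t-cycle. An edge e of G_t lies on two faces, both in one
-- territory when e is interior, one in each of two territories when e ∈ E(Γ), and their union minus e is
-- a cycle of length 2t - 2. It has no chord other than e: inside a territory this is local, because each
-- layer or flap is attached to the older graph only along two consecutive edges (a Ladder). Across
-- territories, vertices of K at distance ≤ 2t in T_K are joined along K by a walk much shorter than the
-- girth of Γ. Colour E(Γ) by M₁, M₂, M₃; walks in Γ are then words in three involutions, and two short
-- reduced words with the same ends coincide. A word along K ∈ 𝒦_i avoids the colour i, so two territories
-- meeting near an edge of colour c share only that edge there.
module Submission where

open import Defs
open import Data.Bool using (T)
import Data.Bool.Properties as Bool
open import Data.Bool.Properties using (T?; T-irrelevant)
open import Data.Empty using (⊥; ⊥-elim)
open import Data.Fin using (Fin; toℕ; fromℕ<)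
import Data.Fin.Properties as Fin
open import Data.Fin.Properties using (toℕ<n; toℕ-injective; toℕ-fromℕ<; any?; all?)
open import Data.Fin.Subset using (Subset; _∈_; _∪_; ⁅_⁆; ∣_∣)
open import Data.Fin.Subset.Properties using (_∈?_; x∈⁅x⁆; x∈⁅y⁆⇒x≡y; x∈p∪q⁻; x∈p∪q⁺; p⊆p∪q; p⊂q⇒∣p∣<∣q∣; ∣p∣≤n)
open import Data.List using (List; []; _∷_; length)
open import Data.List.Relation.Unary.All using (All; []; _∷_)
open import Data.Nat using (ℕ; zero; suc; pred; _+_; _*_; _∸_; _^_; _≤_; _<_; z≤n; s≤s; s≤s⁻¹; NonZero; >-nonZero; _%_; _/_; _≤?_; _<?_)
open import Data.Nat.DivMod
open import Data.Nat.Divisibility using (_∣_; divides; ∣m+n∣m⇒∣n; n∣m*n; ∣n∣m%n⇒∣m)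
open import Data.Nat.Properties
open import Data.Nat.Solver using (module +-*-Solver)
open import Data.Product using (Σ; ∃; _×_; _,_; proj₁; proj₂)
open import Data.Sum using (_⊎_; inj₁; inj₂; [_,_]′)
import Data.Sum as Sum
open import Data.Unit using (⊤; tt)
import Data.Vec.Properties as Vec
open import Function using (_∘_)
open import Function.Bundles using (_⇔_; mk⇔; Equivalence; Inverse)
open import Function.Definitions using (Injective)
open import Relation.Binary.Construct.Closure.ReflexiveTransitive using (Star; ε; _◅_; _◅◅_; reverse; gmap)
open import Relation.Binary.Definitions using (tri<; tri≈; tri>)
open import Relation.Binary.PropositionalEquality hiding (J)
open import Relation.Nullary using (¬_; yes; no; Dec)
open import Relation.Nullary.Decidable using (_×-dec_; _→-dec_; ¬?; toWitness)

-- Induced paths and cycles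

-- The obstacle is that the number m of layers is unbounded while the girth t^(5t) is fixed. Deep
-- layers of T_m contain shortcuts: one step at depth k can be worth (t - 3)^k steps along the
-- boundary. But a walk of n edges that starts on the boundary gets no deeper than n, so it is
-- shadowed by at most n(t - 3)^n boundary steps, whatever m and the expansion are. Only n = 2t is
-- needed: the vertices compared lie on a common cycle of length at most 2t - 2, or on a face and
-- one edge beyond it. A new layer or flap turns boundary edges into interior ones. The induction
-- therefore carries a dichotomy: an edge is either settled for good or lies on the current boundary
-- with one known face, and its second face is supplied by the next layer, by a flap or, in the end,
-- by another territory. That last one exists because an edge of colour c lies on a cycle of 𝒦_i for
-- both i other than c.

Sym : {A : Set} → Rel A → Set
Sym R = ∀ {x y} → R x y → R y x

IsInducedCycle : {A : Set} → Rel A → (p : ℕ) → (Fin p → A) → Set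
IsInducedCycle R p f = Injective _≡_ _≡_ f × (∀ i j → R (f i) (f j) ⇔ CycAdj p i j)

Near : ℕ → ℕ → Set
Near i j = (suc i ≡ j) ⊎ (suc j ≡ i)

Ends : ℕ → ℕ → ℕ → Set
Ends p i j = (i ≡ 0 × suc j ≡ p) ⊎ (suc i ≡ p × j ≡ 0)

-- Vertices are indexed by ℕ and the values of `c` from `n` on are ignored, so that shifting,
-- reversing and concatenating paths is plain function composition, without casts between `Fin`
-- types.
record InducedPath {A : Set} (R : Rel A) (n : ℕ) (c : ℕ → A) : Set where
  field
    inj   : ∀ {i j} → i < n → j < n → c i ≡ c j → i ≡ j
    step  : ∀ {i} → suc i < n → R (c i) (c (suc i))
    chord : ∀ {i j} → i < n → j < n → R (c i) (c j) → Near i j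

record InducedCycle {A : Set} (R : Rel A) (p : ℕ) (c : ℕ → A) : Set where
  field
    inj   : ∀ {i j} → i < p → j < p → c i ≡ c j → i ≡ j
    step  : ∀ {i} → suc i < p → R (c i) (c (suc i))
    close : ∀ {i} → suc i ≡ p → R (c i) (c 0)
    chord : ∀ {i j} → i < p → j < p → R (c i) (c j) → Near i j ⊎ Ends p i j

module _ {A : Set} {R : Rel A} where

  restrictToFin : ∀ {p c} → Sym R → InducedCycle R p c → IsInducedCycle R p (c ∘ toℕ)
  restrictToFin {p} {c} sy C = (λ e → toℕ-injective (inj (toℕ<n _) (toℕ<n _) e)) , λ i j → mk⇔ (fwd i j) (bwd i j)
    where
    open InducedCycle C
    fwd : ∀ i j → R (c (toℕ i)) (c (toℕ j)) → CycAdj p i j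
    fwd i j r with chord (toℕ<n i) (toℕ<n j) r
    ... | inj₁ (inj₁ e) = inj₁ (inj₁ e)
    ... | inj₁ (inj₂ e) = inj₂ (inj₁ e)
    ... | inj₂ (inj₁ (e , e')) = inj₂ (inj₂ (e' , e))
    ... | inj₂ (inj₂ e) = inj₁ (inj₂ e)
    nxt : ∀ i j → Next p i j → R (c (toℕ i)) (c (toℕ j))
    nxt i j (inj₁ e) = subst (λ k → R (c (toℕ i)) (c k)) e (step (subst (_< p) (sym e) (toℕ<n j)))
    nxt i j (inj₂ (e , z)) = subst (λ k → R (c (toℕ i)) (c k)) (sym z) (close e)
    bwd : ∀ i j → CycAdj p i j → R (c (toℕ i)) (c (toℕ j))
    bwd i j (inj₁ n) = nxt i j n
    bwd i j (inj₂ n) = sy (nxt j i n)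

-- Cyclic successors and arithmetic modulo the length of a cycle

module _ {p : ℕ} {{_ : NonZero p}} where

  toℕ-mod : ∀ k → toℕ (k mod p) ≡ k % p
  toℕ-mod k = toℕ-fromℕ< _

  mod-cong : ∀ {a b} → a % p ≡ b % p → a mod p ≡ b mod p
  mod-cong {a} {b} e = toℕ-injective (trans (toℕ-mod a) (trans e (sym (toℕ-mod b))))

  mod-toℕ : ∀ (i : Fin p) → toℕ i mod p ≡ i
  mod-toℕ i = toℕ-injective (trans (toℕ-mod (toℕ i)) (m<n⇒m%n≡m (toℕ<n i)))

  suc-% : ∀ a → suc a % p ≡ suc (a % p) % p
  suc-% a = trans (cong (λ z → suc z % p) (m≡m%n+[m/n]*n a p)) ([m+kn]%n≡m%n (suc (a % p)) (a / p) p)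

  Next⇒% : ∀ {i j} → Next p i j → suc (toℕ i) % p ≡ toℕ j
  Next⇒% {i} {j} (inj₁ e) = trans (cong (_% p) e) (m<n⇒m%n≡m (toℕ<n j))
  Next⇒% (inj₂ (e , z)) = trans (cong (_% p) e) (trans (n%n≡0 p) (sym z))

  %⇒Next : ∀ {i j} → suc (toℕ i) % p ≡ toℕ j → Next p i j
  %⇒Next {i} {j} e with m≤n⇒m<n∨m≡n (toℕ<n i)
  ... | inj₁ l = inj₁ (trans (sym (m<n⇒m%n≡m l)) e)
  ... | inj₂ q = inj₂ (q , trans (sym e) (trans (cong (_% p) q) (n%n≡0 p)))

  Next-mod : ∀ a → Next p (a mod p) (suc a mod p)
  Next-mod a = %⇒Next (trans (cong (λ z → suc z % p) (toℕ-mod a)) (trans (sym (suc-% a)) (sym (toℕ-mod (suc a)))))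

  Next⇒mod : ∀ {a j} → Next p (a mod p) j → suc a mod p ≡ j
  Next⇒mod {a} {j} n = toℕ-injective (trans (toℕ-mod (suc a)) (trans (suc-% a)
    (trans (cong (λ z → suc z % p) (sym (toℕ-mod a))) (Next⇒% n))))

  -- Subtracting `r` is replaced by adding `r * pred p`, which completes `r` to a multiple of `p`.
  +-%-cancel : ∀ r {k k'} → (r + k) % p ≡ (r + k') % p → k % p ≡ k' % p
  +-%-cancel r {k} {k'} e = trans (sym (red k)) (trans (trans (%-distribˡ-+ (r * pred p) (r + k) p)
      (trans (cong (λ z → (r * pred p % p + z) % p) e) (sym (%-distribˡ-+ (r * pred p) (r + k') p)))) (red k'))
    where
    red : ∀ k → (r * pred p + (r + k)) % p ≡ k % p
    red k = trans (cong (_% p) (begin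
        r * pred p + (r + k)   ≡⟨ +-assoc (r * pred p) r k ⟨
        r * pred p + r + k     ≡⟨ cong (_+ k) (+-comm (r * pred p) r) ⟩
        r + r * pred p + k     ≡⟨ cong (_+ k) (sym (*-suc r (pred p))) ⟩
        r * suc (pred p) + k   ≡⟨ cong (λ z → r * z + k) (suc-pred p) ⟩
        r * p + k              ≡⟨ +-comm (r * p) k ⟩
        k + r * p              ∎)) ([m+kn]%n≡m%n k r p)
      where open ≡-Reasoning

  +-mod-cancel : ∀ r {k k'} → k < p → k' < p → (r + k) mod p ≡ (r + k') mod p → k ≡ k'
  +-mod-cancel r {k} {k'} l l' e = trans (sym (m<n⇒m%n≡m l)) (trans
    (+-%-cancel r {k} {k'} (trans (sym (toℕ-mod (r + k))) (trans (cong toℕ e) (toℕ-mod (r + k'))))) (m<n⇒m%n≡m l'))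

  suc-mod-injective : ∀ {a b} → suc a mod p ≡ suc b mod p → a mod p ≡ b mod p
  suc-mod-injective {a} {b} e = mod-cong (+-%-cancel 1 {a} {b} (trans (sym (toℕ-mod (suc a))) (trans (cong toℕ e) (toℕ-mod (suc b)))))

  Next-unique : ∀ {i j j'} → Next p i j → Next p i j' → j ≡ j'
  Next-unique n n' = toℕ-injective (trans (sym (Next⇒% n)) (Next⇒% n'))

  Next-unique⁻ : ∀ {i i' j} → Next p i j → Next p i' j → i ≡ i'
  Next-unique⁻ {i} {i'} {j} n n' = trans (sym (mod-toℕ i)) (trans (suc-mod-injective {toℕ i} {toℕ i'} (trans (s n) (sym (s n')))) (mod-toℕ i'))
    where
    s : ∀ {i} → Next p i j → suc (toℕ i) mod p ≡ j
    s {i} n = toℕ-injective (trans (toℕ-mod (suc (toℕ i))) (Next⇒% n))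

  window : ∀ {A : Set} {R : Rel A} {f} → Sym R → IsInducedCycle R p f → ∀ r → InducedCycle R p (λ k → f ((r + k) mod p))
  window {A} {R} {f} sy (fi , fa) r = record
    { inj = λ l l' e → +-mod-cancel r l l' (fi e)
    ; step = λ {i} _ → from (fa _ _) (inj₁ (nx i))
    ; close = λ {i} e → from (fa _ _) (inj₁ (subst (Next p _) (wrap e) (nx i)))
    ; chord = λ l l' R' → [ one l l' , Sum.map Sum.swap sw ∘ one l' l ]′ (to (fa _ _) R') }
    where
    open Equivalence
    nx : ∀ i → Next p ((r + i) mod p) ((r + suc i) mod p)
    nx i = subst (λ z → Next p ((r + i) mod p) (z mod p)) (sym (+-suc r i)) (Next-mod (r + i))
    wrap : ∀ {i} → suc i ≡ p → (r + suc i) mod p ≡ (r + 0) mod p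
    wrap refl = mod-cong {r + p} {r + 0} (trans ([m+n]%n≡m%n r p) (cong (_% p) (sym (+-identityʳ r))))
    sw : ∀ {i j} → Ends p j i → Ends p i j
    sw (inj₁ (a , b)) = inj₂ (b , a)
    sw (inj₂ (a , b)) = inj₁ (b , a)
    one : ∀ {i j} → i < p → j < p → Next p ((r + i) mod p) ((r + j) mod p) → Near i j ⊎ Ends p i j
    one {i} {j} l l' n with m≤n⇒m<n∨m≡n l
    ... | inj₁ s = inj₁ (inj₁ (+-mod-cancel r s l' (Next-unique (nx i) n)))
    ... | inj₂ e = inj₂ (inj₂ (e , sym (+-mod-cancel r (≤-<-trans z≤n l) l' (trans (sym (wrap e)) (Next-unique (nx i) n)))))

module _ {A : Set} {R : Rel A} where

  prefix : ∀ {p n c} → n < p → InducedCycle R p c → InducedPath R n c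
  prefix {p} {n} l C = record
    { inj = λ a b → inj (<-trans a l) (<-trans b l)
    ; step = λ a → step (<-trans a l)
    ; chord = λ a b r → [ (λ z → z) , (λ e → ⊥-elim (noEnds a b e)) ]′ (chord (<-trans a l) (<-trans b l) r) }
    where
    open InducedCycle C
    noEnds : ∀ {i j} → i < n → j < n → ¬ Ends p i j
    noEnds a b (inj₁ (_ , e)) = <-irrefl e (≤-<-trans b l)
    noEnds a b (inj₂ (e , _)) = <-irrefl e (≤-<-trans a l)

  subpath : ∀ {n c} s {m} → s + m ≤ n → InducedPath R n c → InducedPath R m (λ k → c (s + k))
  subpath {n} {c} s {m} l P = record
    { inj = λ a b e → +-cancelˡ-≡ s _ _ (inj (up a) (up b) e)
    ; step = λ {i} a → subst (λ z → R (c (s + i)) (c z)) (sym (+-suc s i)) (step (subst (_< n) (+-suc s i) (up a)))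
    ; chord = λ {i} {j} a b r → Sum.map (λ e → +-cancelˡ-≡ s _ _ (trans (+-suc s i) e)) (λ e → +-cancelˡ-≡ s _ _ (trans (+-suc s j) e)) (chord (up a) (up b) r) }
    where
    open InducedPath P
    up : ∀ {i} → i < m → s + i < n
    up a = <-≤-trans (+-monoʳ-< s a) l

rev : ℕ → ℕ → ℕ
rev n j = n ∸ suc j

rev-spec : ∀ {n i} → i < n → suc i + rev n i ≡ n
rev-spec l = m+[n∸m]≡n l

rev< : ∀ {n i} → i < n → rev n i < n
rev< {n} {i} l = subst (rev n i <_) (rev-spec l) (s≤s (m≤n+m (rev n i) i))

rev-near : ∀ {n i j} → i < n → j < n → suc (rev n i) ≡ rev n j → suc j ≡ i
rev-near {n} {i} {j} l l' e = suc-injective (+-cancelʳ-≡ (rev n i) _ _ (begin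
    suc (suc j) + rev n i  ≡⟨ cong suc (sym (+-suc j (rev n i))) ⟩
    suc j + suc (rev n i)  ≡⟨ cong (suc j +_) e ⟩
    suc j + rev n j        ≡⟨ rev-spec l' ⟩
    n                      ≡⟨ sym (rev-spec l) ⟩
    suc i + rev n i        ∎))
  where open ≡-Reasoning

rev-inj : ∀ {n i j} → i < n → j < n → rev n i ≡ rev n j → i ≡ j
rev-inj {n} {i} {j} l l' e = suc-injective (+-cancelʳ-≡ (rev n i) _ _ (trans (rev-spec l) (trans (sym (rev-spec l')) (cong (suc j +_) (sym e)))))

rev-suc : ∀ {n i} → suc i < n → rev n i ≡ suc (rev n (suc i))
rev-suc {n} {i} l = +-cancelˡ-≡ (suc i) _ _ (trans (rev-spec (<-trans (n<1+n i) l)) (trans (sym (rev-spec l)) (sym (+-suc (suc i) _))))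

rev-rev : ∀ {n i} → i < n → rev n (rev n i) ≡ i
rev-rev {n} {i} l = +-cancelˡ-≡ (suc (rev n i)) _ _ (trans (rev-spec (rev< l)) (trans (sym (rev-spec l)) (cong suc (+-comm i _))))

module _ {A : Set} {R : Rel A} (sy : Sym R) where

  reversePath : ∀ {n c} → InducedPath R n c → InducedPath R n (c ∘ rev n)
  reversePath {n} {c} P = record
    { inj = λ a b e → rev-inj a b (inj (rev< a) (rev< b) e)
    ; step = λ {i} a → sy (subst (λ z → R (c (rev n (suc i))) (c z)) (sym (rev-suc a)) (step (subst (_< n) (rev-suc a) (rev< (<-trans (n<1+n i) a)))))
    ; chord = λ a b r → [ inj₂ ∘ rev-near a b , inj₁ ∘ rev-near b a ]′ (chord (rev< a) (rev< b) r) }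
    where open InducedPath P

-- Gluing two induced paths into an induced cycle

append : {A : Set} → ℕ → (ℕ → A) → (ℕ → A) → ℕ → A
append zero c d k = d k
append (suc n) c d zero = c 0
append (suc n) c d (suc k) = append n (c ∘ suc) d k

append-< : {A : Set} → ∀ n {c d : ℕ → A} {k} → k < n → append n c d k ≡ c k
append-< (suc n) {k = zero} l = refl
append-< (suc n) {k = suc k} (s≤s l) = append-< n l

append-+ : {A : Set} → ∀ n {c d : ℕ → A} k → append n c d (n + k) ≡ d k
append-+ zero k = refl
append-+ (suc n) k = append-+ n k

data Side (n m : ℕ) : ℕ → Set where
  left  : ∀ {k} → k < n → Side n m k
  right : ∀ {k} → k < m → Side n m (n + k)

side : ∀ n m {k} → k < n + m → Side n m k
side n m {k} l with k <? n
... | yes q = left q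
... | no q = subst (Side n m) (m+[n∸m]≡n n≤k) (right (+-cancelˡ-< n _ _ (subst (_< n + m) (sym (m+[n∸m]≡n n≤k)) l)))
  where n≤k = ≮⇒≥ q

-- The two paths run side by side, joined only first to first and last to last. This is why `glue`
-- traverses the second path backwards.
record Parallel {A : Set} (R : Rel A) (n m : ℕ) (c d : ℕ → A) : Set where
  field
    disjoint : ∀ {i j} → i < n → j < m → c i ≢ d j
    start    : R (c 0) (d 0)
    end      : ∀ {i j} → suc i ≡ n → suc j ≡ m → R (c i) (d j)
    cross    : ∀ {i j} → i < n → j < m → R (c i) (d j) → (i ≡ 0 × j ≡ 0) ⊎ (suc i ≡ n × suc j ≡ m)

module _ {A : Set} {R : Rel A} (sy : Sym R) {n m : ℕ} {c d : ℕ → A}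
         (1≤n : 1 ≤ n) (1≤m : 1 ≤ m) (P : InducedPath R n c) (Q : InducedPath R m d) (X : Parallel R n m c d) where

  private
    module P = InducedPath P
    module Q = InducedPath (reversePath sy Q)
    open Parallel X
    d' : ℕ → A
    d' = d ∘ rev m
    h : ℕ → A
    h = append n c d'
    hl : ∀ {k} → k < n → h k ≡ c k
    hl = append-< n
    hr : ∀ k → h (n + k) ≡ d' k
    hr = append-+ n
    rev0 : ∀ {j} → j < m → rev m j ≡ 0 → suc j ≡ m
    rev0 {j} l e = trans (sym (+-identityʳ (suc j))) (trans (cong (suc j +_) (sym e)) (rev-spec l))
    revm : ∀ {j} → j < m → suc (rev m j) ≡ m → j ≡ 0
    revm {j} l e = +-cancelʳ-≡ (suc (rev m j)) j 0 (trans (+-suc j _) (trans (rev-spec l) (sym e)))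
    rev-last : ∀ {j} → suc j ≡ m → rev m j ≡ 0
    rev-last {j} refl = n∸n≡0 (suc j)
    rev-first : suc (rev m 0) ≡ m
    rev-first = rev-spec 1≤m
    crs : ∀ {i j} → i < n → j < m → R (c i) (d' j) → Near i (n + j) ⊎ Ends (n + m) i (n + j)
    crs {i} {j} a b r with cross a (rev< b) r
    ... | inj₁ (i0 , j0) = inj₂ (inj₁ (i0 , trans (sym (+-suc n j)) (cong (n +_) (rev0 b j0))))
    ... | inj₂ (in' , jm) = inj₁ (inj₁ (trans in' (trans (sym (+-identityʳ n)) (cong (n +_) (sym (revm b jm))))))
    swap' : ∀ {p i j} → Near i j ⊎ Ends p i j → Near j i ⊎ Ends p j i
    swap' (inj₁ x) = inj₁ (Sum.swap x)
    swap' (inj₂ (inj₁ (a , b))) = inj₂ (inj₂ (b , a))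
    swap' (inj₂ (inj₂ (a , b))) = inj₂ (inj₁ (b , a))

    injh : ∀ {i j} → i < n + m → j < n + m → h i ≡ h j → i ≡ j
    injh a b e with side n m a | side n m b
    ... | left x | left y = P.inj x y (trans (sym (hl x)) (trans e (hl y)))
    ... | left x | right {k} y = ⊥-elim (disjoint x (rev< y) (trans (sym (hl x)) (trans e (hr k))))
    ... | right {k} x | left y = ⊥-elim (disjoint y (rev< x) (trans (sym (hl y)) (trans (sym e) (hr k))))
    ... | right {k} x | right {l} y = cong (n +_) (Q.inj x y (trans (sym (hr k)) (trans e (hr l))))

    steph : ∀ {i} → suc i < n + m → R (h i) (h (suc i))
    steph {i} a with side n m (<-trans (n<1+n i) a)
    ... | right {k} y = subst₂ R (sym (hr k)) (trans (sym (hr (suc k))) (cong h (+-suc n k)))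
                          (Q.step (+-cancelˡ-< n _ _ (subst (_< n + m) (sym (+-suc n k)) a)))
    ... | left x with m≤n⇒m<n∨m≡n x
    ...   | inj₁ l = subst₂ R (sym (hl x)) (sym (hl l)) (P.step l)
    ...   | inj₂ e = subst₂ R (sym (hl x)) (trans (sym (hr 0)) (cong h (trans (+-identityʳ n) (sym e)))) (end e rev-first)

    closeh : ∀ {i} → suc i ≡ n + m → R (h i) (h 0)
    closeh {i} e with side n m (subst (i <_) e (n<1+n i))
    ... | left x = ⊥-elim (<-irrefl e (≤-<-trans x (≤-trans (≤-reflexive (+-comm 1 n)) (+-monoʳ-≤ n 1≤m))))
    ... | right {k} y = subst₂ R (trans (cong d (sym (rev-last (+-cancelˡ-≡ n _ _ (trans (+-suc n k) e))))) (sym (hr k)))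
                          (sym (hl 1≤n)) (sy start)

    chordh : ∀ {i j} → i < n + m → j < n + m → R (h i) (h j) → Near i j ⊎ Ends (n + m) i j
    chordh a b r with side n m a | side n m b
    ... | left x | left y = inj₁ (P.chord x y (subst₂ R (hl x) (hl y) r))
    ... | left x | right {k} y = crs x y (subst₂ R (hl x) (hr k) r)
    ... | right {k} x | left y = swap' (crs y x (sy (subst₂ R (hr k) (hl y) r)))
    ... | right {k} x | right {l} y = inj₁ (Sum.map (λ e → trans (sym (+-suc n k)) (cong (n +_) e))
                                                    (λ e → trans (sym (+-suc n l)) (cong (n +_) e)) (Q.chord x y (subst₂ R (hr k) (hr l) r)))

  glue : InducedCycle R (n + m) (append n c (d ∘ rev m))
  glue = record { inj = injh ; step = steph ; close = closeh ; chord = chordh }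

-- Faces at an edge, and the union of two faces

Face : {A : Set} → Rel A → ℕ → A → A → Set
Face R t u v = Σ (Fin t → _) λ f → IsInducedCycle R t f × (∃ λ i → f i ≡ u) × (∃ λ j → f j ≡ v)

module _ {A : Set} {R : Rel A} where

  Delete-sym : ∀ {u v} → Sym R → Sym (DeleteEdge R u v)
  Delete-sym sy (r , k) = sy r , λ { (inj₁ (a , b)) → k (inj₂ (b , a)) ; (inj₂ (a , b)) → k (inj₁ (b , a)) }

  Delete-swap : ∀ {u v x y} → DeleteEdge R u v x y → DeleteEdge R v u x y
  Delete-swap (r , k) = r , k ∘ Sum.swap

  avoid : ∀ {n c w w'} → (∀ {i} → i < n → c i ≢ w) → InducedPath R n c → InducedPath (DeleteEdge R w w') n c
  avoid av P = record
    { inj = inj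
    ; step = λ l → step l , λ { (inj₁ (a , _)) → av (<-trans (n<1+n _) l) a ; (inj₂ (_ , b)) → av l b }
    ; chord = λ a b r → chord a b (proj₁ r) }
    where open InducedPath P

  swapPath : ∀ {n c u v} → InducedPath (DeleteEdge R u v) n c → InducedPath (DeleteEdge R v u) n c
  swapPath P = record { inj = inj ; step = Delete-swap ∘ step ; chord = λ a b → chord a b ∘ Delete-swap }
    where open InducedPath P

  -- The closing edge is the only chord of the path through all the vertices, and with at least
  -- three vertices it differs from every edge of that path.
  cutCycle : ∀ {q c} → InducedCycle R (3 + q) c → InducedPath (DeleteEdge R (c 0) (c (2 + q))) (3 + q) c
  cutCycle {q} {c} C = record
    { inj = inj
    ; step = λ {i} l → step l , λ
        { (inj₁ (a , b)) → 1≢2+ (trans (cong suc (sym (inj (<-trans (n<1+n _) l) (s≤s z≤n) a))) (inj l ≤-refl b))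
        ; (inj₂ (_ , b)) → 1+n≢0 (inj l (s≤s z≤n) b) }
    ; chord = λ a b (r , k) → [ (λ z → z) , (λ e → ⊥-elim (k (ends e))) ]′ (chord a b r) }
    where
    open InducedCycle C
    1≢2+ : ∀ {n} → ¬ (1 ≡ 2 + n)
    1≢2+ ()
    ends : ∀ {i j} → Ends (3 + q) i j → (c i ≡ c 0 × c j ≡ c (2 + q)) ⊎ (c i ≡ c (2 + q) × c j ≡ c 0)
    ends (inj₁ (refl , refl)) = inj₁ (refl , refl)
    ends (inj₂ (refl , refl)) = inj₂ (refl , refl)

record CutFace {A : Set} (R : Rel A) (q : ℕ) (f : Fin (3 + q) → A) (u v : A) : Set where
  field
    c      : ℕ → A
    first  : c 0 ≡ u
    last   : c (2 + q) ≡ v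
    path   : InducedPath (DeleteEdge R u v) (3 + q) c
    member : ∀ k → ∃ λ i → f i ≡ c k

cutForward : {A : Set} {R : Rel A} → Sym R → ∀ {q f} → IsInducedCycle R (3 + q) f → ∀ {i j} → Next (3 + q) j i → CutFace R q f (f i) (f j)
cutForward {A} {R} sy {q} {f} F {i} {j} n = record
  { c = c ; first = first ; last = last
  ; path = subst₂ (λ u v → InducedPath (DeleteEdge R u v) (3 + q) c) first last (cutCycle (window sy F (toℕ i)))
  ; member = λ k → _ , refl }
  where
  c : ℕ → A
  c k = f ((toℕ i + k) mod (3 + q))
  first : c 0 ≡ f i
  first = cong f (trans (cong (_mod (3 + q)) (+-identityʳ (toℕ i))) (mod-toℕ i))
  around : suc (toℕ i + (2 + q)) mod (3 + q) ≡ i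
  around = trans (mod-cong {3 + q} {{_}} {suc (toℕ i + (2 + q))} {toℕ i}
    (trans (cong (_% (3 + q)) (sym (+-suc (toℕ i) (2 + q)))) ([m+n]%n≡m%n (toℕ i) (3 + q)))) (mod-toℕ i)
  last : c (2 + q) ≡ f j
  last = cong f (Next-unique⁻ (subst (Next (3 + q) ((toℕ i + (2 + q)) mod (3 + q))) around (Next-mod (toℕ i + (2 + q)))) n)

reverseCut : {A : Set} {R : Rel A} → Sym R → ∀ {q f u v} → CutFace R q f v u → CutFace R q f u v
reverseCut sy {q} C = record
    { c = c ∘ rev (3 + q) ; first = last
    ; last = trans (cong c (n∸n≡0 q)) first
    ; path = reversePath (Delete-sym sy) (swapPath path)
    ; member = λ k → member (rev (3 + q) k) }
  where open CutFace C

-- `Face` does not say that its two vertices are consecutive; an edge between two vertices of an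
-- induced cycle must belong to the cycle, which gives the place to cut.
cut : {A : Set} {R : Rel A} → Sym R → ∀ {q u v} (F : Face R (3 + q) u v) → R u v → CutFace R q (proj₁ F) u v
cut sy {q} (f , F , (i , refl) , (j , refl)) r with Equivalence.to (proj₂ F i j) r
... | inj₂ n = cutForward sy {q} {f} F n
... | inj₁ n = reverseCut sy (cutForward sy {q} {f} F n)

-- Cut both cycles at `uv`. All 3 + q vertices of `F` and the 1 + q inner vertices of `G` then form
-- parallel paths, whence the length 4 + 2q, and the one chord of the glued cycle is the deleted
-- edge.
merge : {A : Set} {R : Rel A} → Sym R → ∀ {q u v} → R u v → (F G : Face R (3 + q) u v) →
        (∀ i j → proj₁ F i ≢ u → proj₁ F i ≢ v → proj₁ G j ≢ u → proj₁ G j ≢ v →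
                 proj₁ F i ≢ proj₁ G j × ¬ R (proj₁ F i) (proj₁ G j)) →
        HasInducedCycle (DeleteEdge R u v) (4 + (q + q))
merge {A} {R} sy {q} {u} {v} uv F G apart = subst (HasInducedCycle R') (cong (3 +_) (+-suc q q))
  (_ , restrictToFin sy' (glue sy' (s≤s z≤n) (s≤s z≤n) C.path (subpath 1 (n≤1+n (2 + q)) D.path) parallel))
  where
  R' = DeleteEdge R u v
  sy' : Sym R'
  sy' = Delete-sym sy
  module C = CutFace (cut sy F uv)
  module D = CutFace (cut sy G uv)
  module CP = InducedPath C.path
  module DP = InducedPath D.path
  far : ∀ {i j} → C.c i ≢ u → C.c i ≢ v → D.c j ≢ u → D.c j ≢ v → C.c i ≢ D.c j × ¬ R (C.c i) (D.c j)
  far {i} {j} a b c d with C.member i | D.member j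
  ... | i' , e | j' , e' = subst₂ (λ x y → x ≢ y × ¬ R x y) e e'
      (apart i' j' (a ∘ trans (sym e)) (b ∘ trans (sym e)) (c ∘ trans (sym e')) (d ∘ trans (sym e')))
  up : ∀ {j} → j < 1 + q → 1 + j < 3 + q
  up b = ≤-trans (s≤s b) (n≤1+n _)
  dNotU : ∀ {j} → j < 1 + q → D.c (1 + j) ≢ u
  dNotU l e = 1+n≢0 (DP.inj (up l) (s≤s z≤n) (trans e (sym D.first)))
  dNotV : ∀ {j} → j < 1 + q → D.c (1 + j) ≢ v
  dNotV l e = <⇒≢ l (suc-injective (DP.inj (up l) ≤-refl (trans e (sym D.last))))
  data Pos (i : ℕ) : Set where
    first : i ≡ 0 → Pos i
    last  : i ≡ 2 + q → Pos i
    mid   : C.c i ≢ u → C.c i ≢ v → Pos i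
  pos : ∀ {i} → i < 3 + q → Pos i
  pos {i} l with i ≟ 0 | i ≟ 2 + q
  ... | yes e | _ = first e
  ... | no _  | yes e = last e
  ... | no a  | no b = mid (λ e → a (CP.inj l (s≤s z≤n) (trans e (sym C.first))))
                           (λ e → b (CP.inj l ≤-refl (trans e (sym C.last))))
  disj : ∀ {i j} → i < 3 + q → j < 1 + q → C.c i ≢ D.c (1 + j)
  disj a b e with pos a
  ... | first refl = dNotU b (trans (sym e) C.first)
  ... | last refl = dNotV b (trans (sym e) C.last)
  ... | mid x y = proj₁ (far x y (dNotU b) (dNotV b)) e
  crs : ∀ {i j} → i < 3 + q → j < 1 + q → R' (C.c i) (D.c (1 + j)) → (i ≡ 0 × j ≡ 0) ⊎ (suc i ≡ 3 + q × suc j ≡ 1 + q)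
  crs {i} {j} a b r with pos a
  ... | mid x y = ⊥-elim (proj₂ (far x y (dNotU b) (dNotV b)) (proj₁ r))
  -- The ends `u` and `v` also belong to the full cut path of `G`, so inducedness of that path
  -- locates their neighbours.
  crs {i} {j} a b r | first refl with DP.chord (s≤s z≤n) (up b) (subst (λ z → R' z (D.c (1 + j))) (trans C.first (sym D.first)) r)
  ...   | inj₁ e = inj₁ (refl , sym (suc-injective e))
  ...   | inj₂ ()
  crs {i} {j} a b r | last refl with DP.chord ≤-refl (up b) (subst (λ z → R' z (D.c (1 + j))) (trans C.last (sym D.last)) r)
  ...   | inj₂ e = inj₂ (refl , suc-injective e)
  ...   | inj₁ e = ⊥-elim (<⇒≢ (up b) (sym e))
  parallel : Parallel R' (3 + q) (1 + q) C.c (D.c ∘ suc)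
  parallel = record
    { disjoint = disj
    ; start = subst (λ z → R' z (D.c 1)) (trans D.first (sym C.first)) (DP.step (s≤s (s≤s z≤n)))
    ; end = λ { refl refl → subst (λ z → R' z (D.c (1 + q))) (trans D.last (sym C.last)) (sy' (DP.step ≤-refl)) }
    ; cross = crs }

-- Gluing ladders of faces

record Embedding {A V : Set} (OE : Rel A) (R : Rel V) (e : A → V) : Set where
  field
    symO   : Sym OE
    irrO   : ∀ {x} → ¬ OE x x
    symR   : Sym R
    inject : ∀ {x y} → e x ≡ e y → x ≡ y
    emb→   : ∀ {x y} → OE x y → R (e x) (e y)
    emb←   : ∀ {x y} → R (e x) (e y) → OE x y

module _ {A V : Set} {OE : Rel A} {R : Rel V} {e : A → V} (E : Embedding OE R e) where
  open Embedding E

  liftCycle : ∀ {p f} → IsInducedCycle OE p f → IsInducedCycle R p (e ∘ f)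
  liftCycle (i , a) = i ∘ inject , λ x y → mk⇔ (Equivalence.to (a x y) ∘ emb←) (emb→ ∘ Equivalence.from (a x y))

  liftFace : ∀ {t x y} → Face OE t x y → Face R t (e x) (e y)
  liftFace (f , F , (i , p) , (j , q)) = e ∘ f , liftCycle {f = f} F , (i , cong e p) , (j , cong e q)

  liftDelete : ∀ {p x y} → HasInducedCycle (DeleteEdge OE x y) p → HasInducedCycle (DeleteEdge R (e x) (e y)) p
  liftDelete (f , i , a) = e ∘ f , i ∘ inject , λ x y → mk⇔
    (λ (r , k) → Equivalence.to (a x y) (emb← r , k ∘ Sum.map (λ (p , q) → cong e p , cong e q) (λ (p , q) → cong e p , cong e q)))
    (λ c → let (r , k) = Equivalence.from (a x y) c in
           emb→ r , k ∘ Sum.map (λ (p , q) → inject p , inject q) (λ (p , q) → inject p , inject q))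

-- Two t-faces x y ρ_s … ρ_0 and y z ρ_{2s} … ρ_s glued to an old graph along x-y-z, where t = 3 + s:
-- both the strips of T_m and the flaps of an expansion have this shape.
record Ladder {A V : Set} (OE : Rel A) (R : Rel V) (e : A → V) (s : ℕ) : Set where
  field
    ρ     : ℕ → V
    x y z : A
    xy    : OE x y
    yz    : OE y z
    x≁z   : ¬ OE x z
    x≢z   : x ≢ z
    path  : InducedPath R (suc (s + s)) ρ
    new   : ∀ {u k} → k ≤ s + s → e u ≢ ρ k
    link  : ∀ {u k} → k ≤ s + s → R (e u) (ρ k) → (k ≡ 0 × u ≡ x) ⊎ (k ≡ s × u ≡ y) ⊎ (k ≡ s + s × u ≡ z)
    linkx : R (e x) (ρ 0)
    linky : R (e y) (ρ s)
    linkz : R (e z) (ρ (s + s))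

-- Mirror image, so that only the face over `xy` has to be built: the face over `yz` is the same
-- face of the flipped ladder.
flip : ∀ {A V : Set} {OE : Rel A} {R : Rel V} {e : A → V} {s} → Embedding OE R e → Ladder OE R e s → Ladder OE R e s
flip {R = R} {e} {s} E L = record
  { ρ = ρ ∘ rev (suc (s + s)) ; x = z ; y = y ; z = x
  ; xy = symO yz ; yz = symO xy ; x≁z = x≁z ∘ symO ; x≢z = x≢z ∘ sym
  ; path = reversePath symR path
  ; new = λ {_} {k} l → new (m∸n≤m (s + s) k)
  ; link = λ {u} {k} l r → lk l (link (m∸n≤m (s + s) k) r)
  ; linkx = linkz
  ; linky = subst (λ k → R (e y) (ρ k)) (sym (m+n∸n≡m s s)) linky
  ; linkz = subst (λ k → R (e x) (ρ k)) (sym (n∸n≡0 (s + s))) linkx }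
  where
  open Embedding E
  open Ladder L
  lk : ∀ {u k} → k ≤ s + s →
       (s + s ∸ k ≡ 0 × u ≡ x) ⊎ (s + s ∸ k ≡ s × u ≡ y) ⊎ (s + s ∸ k ≡ s + s × u ≡ z) →
       (k ≡ 0 × u ≡ z) ⊎ (k ≡ s × u ≡ y) ⊎ (k ≡ s + s × u ≡ x)
  lk l (inj₁ (p , q)) = inj₂ (inj₂ (≤-antisym l (m∸n≡0⇒m≤n p) , q))
  lk {k = k} l (inj₂ (inj₁ (p , q))) = inj₂ (inj₁ (+-cancelʳ-≡ s k s (trans (cong (k +_) (sym p)) (m+[n∸m]≡n l)) , q))
  lk {k = k} l (inj₂ (inj₂ (p , q))) = inj₁ (+-cancelʳ-≡ (s + s) k 0 (trans (cong (k +_) (sym p)) (m+[n∸m]≡n l)) , q)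

pair : {A : Set} → A → A → ℕ → A
pair a b 0 = a
pair a b (suc _) = b

triple : {A : Set} → A → A → A → ℕ → A
triple a b c 0 = a
triple a b c (suc n) = pair b c n

module _ {A : Set} {R : Rel A} (sy : Sym R) (irr : ∀ {x} → ¬ R x x) where

  pairPath : ∀ {a b} → R a b → InducedPath R 2 (pair a b)
  pairPath {a} {b} ab = record { inj = i ; step = λ { {0} _ → ab ; {suc _} (s≤s (s≤s ())) } ; chord = c }
    where
    i : ∀ {i j} → i < 2 → j < 2 → pair a b i ≡ pair a b j → i ≡ j
    i {0} {0} _ _ _ = refl
    i {0} {1} _ _ refl = ⊥-elim (irr ab)
    i {1} {0} _ _ refl = ⊥-elim (irr ab)
    i {1} {1} _ _ _ = refl
    i {suc (suc _)} (s≤s (s≤s ()))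
    i {_} {suc (suc _)} _ (s≤s (s≤s ()))
    c : ∀ {i j} → i < 2 → j < 2 → R (pair a b i) (pair a b j) → Near i j
    c {0} {0} _ _ r = ⊥-elim (irr r)
    c {0} {1} _ _ r = inj₁ refl
    c {1} {0} _ _ r = inj₂ refl
    c {1} {1} _ _ r = ⊥-elim (irr r)
    c {suc (suc _)} (s≤s (s≤s ()))
    c {_} {suc (suc _)} _ (s≤s (s≤s ()))

  triplePath : ∀ {a b c} → R a b → R b c → a ≢ c → ¬ R a c → InducedPath R 3 (triple a b c)
  triplePath {a} {b} {c} ab bc a≢c a≁c = record { inj = i ; step = st ; chord = ch }
    where
    module P = InducedPath (pairPath bc)
    i : ∀ {i j} → i < 3 → j < 3 → triple a b c i ≡ triple a b c j → i ≡ j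
    i {0} {0} _ _ _ = refl
    i {0} {1} _ _ refl = ⊥-elim (irr ab)
    i {0} {suc (suc _)} _ _ e = ⊥-elim (a≢c e)
    i {1} {0} _ _ refl = ⊥-elim (irr ab)
    i {suc (suc _)} {0} _ _ e = ⊥-elim (a≢c (sym e))
    i {suc i'} {suc j'} (s≤s l) (s≤s l') e = cong suc (P.inj l l' e)
    st : ∀ {i} → suc i < 3 → R (triple a b c i) (triple a b c (suc i))
    st {0} _ = ab
    st {suc i} (s≤s l) = P.step l
    ch : ∀ {i j} → i < 3 → j < 3 → R (triple a b c i) (triple a b c j) → Near i j
    ch {0} {0} _ _ r = ⊥-elim (irr r)
    ch {0} {1} _ _ r = inj₁ refl
    ch {0} {suc (suc _)} _ _ r = ⊥-elim (a≁c r)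
    ch {1} {0} _ _ r = inj₂ refl
    ch {suc (suc _)} {0} _ _ r = ⊥-elim (a≁c (sy r))
    ch {suc i'} {suc j'} (s≤s l) (s≤s l') r = Sum.map (cong suc) (cong suc) (P.chord l l' r)

module _ {A V : Set} {OE : Rel A} {R : Rel V} {e : A → V} (E : Embedding OE R e) where
  open Embedding E

  liftPath : ∀ {n c} → InducedPath OE n c → InducedPath R n (e ∘ c)
  liftPath P = record { inj = λ a b → inj a b ∘ inject ; step = emb→ ∘ step ; chord = λ a b → chord a b ∘ emb← }
    where open InducedPath P

record LeftFace {A V : Set} {OE : Rel A} {R : Rel V} {e : A → V} {s : ℕ} (L : Ladder OE R e s) : Set where
  open Ladder L
  field
    f       : Fin (3 + s) → V
    induced : IsInducedCycle R (3 + s) f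
    vertex  : ∀ i → (f i ≡ e x ⊎ f i ≡ e y) ⊎ ∃ λ k → k ≤ s × f i ≡ ρ k
    atx     : ∃ λ i → f i ≡ e x
    aty     : ∃ λ i → f i ≡ e y
    atρ     : ∀ {k} → k ≤ s → ∃ λ i → f i ≡ ρ k

module _ {A V : Set} {OE : Rel A} {R : Rel V} {e : A → V} (E : Embedding OE R e)
         {s : ℕ} (1≤s : 1 ≤ s) (L : Ladder OE R e s) where
  open Embedding E
  open Ladder L

  private
    x≢y : x ≢ y
    x≢y p = irrO (subst (OE x) (sym p) xy)
    y≢z : y ≢ z
    y≢z p = irrO (subst (OE y) (sym p) yz)
    s≤2s : s ≤ s + s
    s≤2s = m≤m+n s s

  leftFace : LeftFace L
  leftFace = record
    { f = _
    ; induced = restrictToFin symR (glue symR (s≤s z≤n) (s≤s z≤n) (liftPath E (pairPath symO irrO xy)) (subpath 0 (s≤s s≤2s) path) par)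
    ; vertex = cls ; atx = Fin.zero , refl ; aty = Fin.suc Fin.zero , refl ; atρ = mem }
    where
    up : ∀ {j} → j < suc s → j ≤ s + s
    up (s≤s l) = ≤-trans l s≤2s
    c : ∀ {i j} → i < 2 → j < suc s → R (e (pair x y i)) (ρ j) → (i ≡ 0 × j ≡ 0) ⊎ (suc i ≡ 2 × suc j ≡ suc s)
    c {0} _ l r with link (up l) r
    ... | inj₁ (p , _) = inj₁ (refl , p)
    ... | inj₂ (inj₁ (_ , p)) = ⊥-elim (x≢y p)
    ... | inj₂ (inj₂ (_ , p)) = ⊥-elim (x≢z p)
    c {1} _ l r with link (up l) r
    ... | inj₁ (_ , p) = ⊥-elim (x≢y (sym p))
    ... | inj₂ (inj₁ (p , _)) = inj₂ (refl , cong suc p)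
    ... | inj₂ (inj₂ (_ , p)) = ⊥-elim (y≢z p)
    c {suc (suc _)} (s≤s (s≤s ()))
    par : Parallel R 2 (suc s) (e ∘ pair x y) ρ
    par = record { disjoint = λ _ l → new (up l) ; start = linkx ; end = λ { refl refl → linky } ; cross = c }
    cls : ∀ i → _
    cls Fin.zero = inj₁ (inj₁ refl)
    cls (Fin.suc Fin.zero) = inj₁ (inj₂ refl)
    cls (Fin.suc (Fin.suc i)) = inj₂ (s ∸ toℕ i , m∸n≤m s (toℕ i) , refl)
    mem : ∀ {k} → k ≤ s → _
    mem {k} l = Fin.suc (Fin.suc (fromℕ< (s≤s (m∸n≤m s k)))) , cong ρ (trans (cong (s ∸_) (toℕ-fromℕ< (s≤s (m∸n≤m s k)))) (m∸[m∸n]≡n l))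

  open LeftFace leftFace

  face-xy : Face R (3 + s) (e x) (e y)
  face-xy = f , induced , atx , aty

  face-rung : Face R (3 + s) (e x) (ρ 0)
  face-rung = f , induced , atx , atρ z≤n

  face-ρ : ∀ {k} → suc k ≤ s → Face R (3 + s) (ρ k) (ρ (suc k))
  face-ρ l = f , induced , atρ (≤-trans (n≤1+n _) l) , atρ l

  -- The older face on one side of `xy` is merged with the new one on the other. The vertices `ρ 0`,
  -- ..., `ρ s` have no old neighbours except `x` and `y`, since `z` is attached only at
  -- `ρ (s + s)`, beyond this half.
  good-xy : Face OE (3 + s) x y → HasInducedCycle (DeleteEdge R (e x) (e y)) (4 + (s + s))
  good-xy O = merge {R = R} symR (emb→ xy) (liftFace E O) face-xy apart
    where
    apart : ∀ i j → e (proj₁ O i) ≢ e x → e (proj₁ O i) ≢ e y → f j ≢ e x → f j ≢ e y →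
            e (proj₁ O i) ≢ f j × ¬ R (e (proj₁ O i)) (f j)
    apart i j a b c d with vertex j
    ... | inj₁ (inj₁ p) = ⊥-elim (c p)
    ... | inj₁ (inj₂ p) = ⊥-elim (d p)
    ... | inj₂ (k , l , p) = subst (λ v → e (proj₁ O i) ≢ v × ¬ R (e (proj₁ O i)) v) (sym p)
        (new (≤-trans l s≤2s) , λ r → no' (link (≤-trans l s≤2s) r))
      where
      no' : ¬ ((k ≡ 0 × proj₁ O i ≡ x) ⊎ (k ≡ s × proj₁ O i ≡ y) ⊎ (k ≡ s + s × proj₁ O i ≡ z))
      no' (inj₁ (_ , p)) = a (cong e p)
      no' (inj₂ (inj₁ (_ , p))) = b (cong e p)
      no' (inj₂ (inj₂ (p , _))) = <⇒≢ (≤-<-trans l (m<m+n s 1≤s)) p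

  -- The two faces at the middle rung are the two halves of the ladder. Their outline is x y z
  -- followed by all of `ρ` backwards, and the rung is its only chord.
  good-rung : HasInducedCycle (DeleteEdge R (e y) (ρ s)) (4 + (s + s))
  good-rung = _ , restrictToFin sy' (glue sy' (s≤s z≤n) (s≤s z≤n)
      (swapPath (avoid (λ _ → new s≤2s) (liftPath E (triplePath symO irrO xy yz x≢z x≁z))))
      (avoid (λ { (s≤s l) p → new l (sym p) }) path) par)
    where
    sy' : Sym (DeleteEdge R (e y) (ρ s))
    sy' = Delete-sym symR
    keep : ∀ {u k} → u ≢ y → R (e u) (ρ k) → DeleteEdge R (e y) (ρ s) (e u) (ρ k)
    keep n r = r , λ { (inj₁ (p , _)) → n (inject p) ; (inj₂ (p , _)) → new s≤2s p }
    c : ∀ {i j} → i < 3 → j < suc (s + s) → DeleteEdge R (e y) (ρ s) (e (triple x y z i)) (ρ j) →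
        (i ≡ 0 × j ≡ 0) ⊎ (suc i ≡ 3 × suc j ≡ suc (s + s))
    c {0} _ (s≤s l) (r , _) with link l r
    ... | inj₁ (p , _) = inj₁ (refl , p)
    ... | inj₂ (inj₁ (_ , p)) = ⊥-elim (x≢y p)
    ... | inj₂ (inj₂ (_ , p)) = ⊥-elim (x≢z p)
    c {1} _ (s≤s l) (r , k) with link l r
    ... | inj₁ (_ , p) = ⊥-elim (x≢y (sym p))
    ... | inj₂ (inj₁ (p , _)) = ⊥-elim (k (inj₁ (refl , cong ρ p)))
    ... | inj₂ (inj₂ (_ , p)) = ⊥-elim (y≢z p)
    c {2} _ (s≤s l) (r , _) with link l r
    ... | inj₁ (_ , p) = ⊥-elim (x≢z (sym p))
    ... | inj₂ (inj₁ (_ , p)) = ⊥-elim (y≢z (sym p))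
    ... | inj₂ (inj₂ (p , _)) = inj₂ (refl , cong suc p)
    c {suc (suc (suc _))} (s≤s (s≤s (s≤s ())))
    par : Parallel (DeleteEdge R (e y) (ρ s)) 3 (suc (s + s)) (e ∘ triple x y z) ρ
    par = record { disjoint = λ { _ (s≤s l) → new l } ; start = keep x≢y linkx
                 ; end = λ { refl refl → keep (y≢z ∘ sym) linkz } ; cross = c }

-- The further t-face ρ_{s-1} ρ_s ρ_{s+1} ζ_{s-1} … ζ_0 over the middle of the ladder, present when Q_i is.
record Pocket {A V : Set} {OE : Rel A} {R : Rel V} {e : A → V} {s : ℕ} (L : Ladder OE R e s) : Set where
  open Ladder L
  field
    ζ      : ℕ → V
    ζpath  : InducedPath R s ζ
    ζfar   : ∀ {u j} → j < s → e u ≢ ζ j × ¬ R (e u) (ζ j)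
    ρ≢ζ    : ∀ {k j} → k ≤ s + s → j < s → ρ k ≢ ζ j
    ζlink  : ∀ {k j} → k ≤ s + s → j < s → R (ρ k) (ζ j) → (suc k ≡ s × j ≡ 0) ⊎ (k ≡ suc s × suc j ≡ s)
    ζfirst : ∀ {k} → suc k ≡ s → R (ρ k) (ζ 0)
    ζlast  : ∀ {j} → suc j ≡ s → R (ρ (suc s)) (ζ j)

module _ {A V : Set} {OE : Rel A} {R : Rel V} {e : A → V} (E : Embedding OE R e) where
  open Embedding E

  flipPocket : ∀ {s} → 1 ≤ s → (L : Ladder OE R e s) → Pocket L → Pocket (flip E L)
  flipPocket {s} 1≤s L Q = record
    { ζ = ζ ∘ rev s
    ; ζpath = reversePath symR ζpath
    ; ζfar = ζfar ∘ rev<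
    ; ρ≢ζ = λ {k} _ l' → ρ≢ζ (m∸n≤m (s + s) k) (rev< l')
    ; ζlink = λ {k} {j} l l' r → lk l l' (ζlink (m∸n≤m (s + s) k) (rev< l') r)
    ; ζfirst = λ {k} p → subst (λ m → R (ρ m) (ζ (rev s 0))) (sym (opp k p)) (ζlast (rev-spec 1≤s))
    ; ζlast = λ { {j} refl → subst₂ (λ a b → R (ρ a) (ζ b)) (sym (m+n∸n≡m j (suc j))) (sym (n∸n≡0 j)) (ζfirst refl) } }
    where
    open Ladder L
    open Pocket Q
    opp : ∀ k → suc k ≡ s → s + s ∸ k ≡ suc s
    opp k refl = trans (cong (λ z → suc z ∸ k) (+-suc k k)) (m+n∸n≡m (suc (suc k)) k)
    lk : ∀ {k j} → k ≤ s + s → j < s → (suc (s + s ∸ k) ≡ s × rev s j ≡ 0) ⊎ (s + s ∸ k ≡ suc s × suc (rev s j) ≡ s) →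
         (suc k ≡ s × j ≡ 0) ⊎ (k ≡ suc s × suc j ≡ s)
    lk {k} {j} l l' (inj₁ (p , q)) = inj₂ (+-cancelʳ-≡ (s + s ∸ k) k (suc s)
          (trans (m+[n∸m]≡n l) (trans (cong (s +_) (sym p)) (+-suc s (s + s ∸ k))))
        , trans (sym (+-identityʳ (suc j))) (trans (cong (suc j +_) (sym q)) (rev-spec l')))
    lk {k} {j} l l' (inj₂ (p , q)) = inj₁ (+-cancelʳ-≡ s (suc k) s (trans (sym (+-suc k s)) (trans (cong (k +_) (sym p)) (m+[n∸m]≡n l)))
        , +-cancelʳ-≡ (suc (rev s j)) j 0 (trans (+-suc j _) (trans (rev-spec l') (sym q))))

  module _ {r : ℕ} (L : Ladder OE R e (suc (suc r))) (Q : Pocket L) where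
    open Ladder L
    open Pocket Q
    private
      s = suc (suc r)
      s≤2s : s ≤ s + s
      s≤2s = m≤m+n s s
      -- This is where `s` has to be at least 2, that is t at least 5: `ρ (suc s)` is then not the
      -- last vertex of the path and has no old neighbour.
      s+1<2s : suc s < s + s
      s+1<2s = s≤s (s≤s (m≤n+m s r))
      mid : ℕ → V
      mid k = ρ (suc r + k)
      midP : InducedPath R 3 mid
      midP = subpath (suc r) (s≤s (≤-trans (≤-reflexive (+-comm r 3)) (<⇒≤ s+1<2s))) path

    record PocketFace : Set where
      field
        f       : Fin (3 + s) → V
        induced : IsInducedCycle R (3 + s) f
        vertex  : ∀ i → (f i ≡ ρ (suc r) ⊎ f i ≡ ρ s) ⊎ (f i ≡ ρ (suc s) ⊎ (∃ λ j → j < s × f i ≡ ζ j))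
        atl     : ∃ λ i → f i ≡ ρ (suc r)
        atm     : ∃ λ i → f i ≡ ρ s
        atr     : ∃ λ i → f i ≡ ρ (suc s)
        atζ     : ∀ {j} → j < s → ∃ λ i → f i ≡ ζ j

    private
      m0 : suc r + 0 ≡ suc r
      m0 = +-identityʳ (suc r)
      m1 : suc r + 1 ≡ s
      m1 = +-comm (suc r) 1
      m2 : suc r + 2 ≡ suc s
      m2 = +-comm (suc r) 2

    pocketFace : PocketFace
    pocketFace = record
      { f = _
      ; induced = restrictToFin symR (glue symR (s≤s z≤n) (s≤s z≤n) midP ζpath par)
      ; vertex = cls ; atl = Fin.zero , cong ρ m0 ; atm = Fin.suc Fin.zero , cong ρ m1
      ; atr = Fin.suc (Fin.suc Fin.zero) , cong ρ m2 ; atζ = mem }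
      where
      low : ∀ {i} → i < 3 → suc r + i ≤ s + s
      low {i} (s≤s l) = ≤-trans (+-monoʳ-≤ (suc r) l) (≤-trans (≤-reflexive m2) (<⇒≤ s+1<2s))
      c : ∀ {i j} → i < 3 → j < s → R (mid i) (ζ j) → (i ≡ 0 × j ≡ 0) ⊎ (suc i ≡ 3 × suc j ≡ s)
      c {i} a b q with ζlink (low a) b q
      ... | inj₁ (p , p') = inj₁ (+-cancelˡ-≡ (suc r) i 0 (trans (suc-injective p) (sym m0)) , p')
      ... | inj₂ (p , p') = inj₂ (cong suc (+-cancelˡ-≡ (suc r) i 2 (trans p (sym m2))) , p')
      par : Parallel R 3 s mid ζ
      par = record { disjoint = λ a → ρ≢ζ (low a)
                   ; start = subst (λ k → R (ρ k) (ζ 0)) (sym m0) (ζfirst refl)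
                   ; end = λ { {j = j} refl q → subst (λ k → R (ρ k) (ζ j)) (sym m2) (ζlast q) }
                   ; cross = c }
      cls : ∀ i → _
      cls Fin.zero = inj₁ (inj₁ (cong ρ m0))
      cls (Fin.suc Fin.zero) = inj₁ (inj₂ (cong ρ m1))
      cls (Fin.suc (Fin.suc Fin.zero)) = inj₂ (inj₁ (cong ρ m2))
      cls (Fin.suc (Fin.suc (Fin.suc i))) = inj₂ (inj₂ (rev s (toℕ i) , rev< (toℕ<n i) , refl))
      mem : ∀ {j} → j < s → _
      mem {j} l = Fin.suc (Fin.suc (Fin.suc (fromℕ< (rev< l)))) , cong ζ (trans (cong (rev s) (toℕ-fromℕ< (rev< l))) (rev-rev l))

    -- With a pocket present, the edges of `ρ` at its middle vertex become interior: their second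
    -- face is the pocket. The edge on the other side of the middle is covered by flipping.
    good-mid : HasInducedCycle (DeleteEdge R (ρ (suc r)) (ρ s)) (4 + (s + s))
    good-mid = merge {R = R} symR (InducedPath.step path (s≤s s≤2s)) (face-ρ E (s≤s z≤n) L ≤-refl)
      (P.f , P.induced , P.atl , P.atm) apart
      where
      module P = PocketFace pocketFace
      module F = LeftFace (leftFace E (s≤s z≤n) L)
      Far : V → V → Set
      Far a b = a ≢ b × ¬ R a b
      oldρ : ∀ {u} → (suc s ≡ 0 × u ≡ x) ⊎ (suc s ≡ s × u ≡ y) ⊎ (suc s ≡ s + s × u ≡ z) → ⊥
      oldρ (inj₁ ())
      oldρ (inj₂ (inj₁ (p , _))) = 1+n≢n p
      oldρ (inj₂ (inj₂ (p , _))) = <⇒≢ s+1<2s p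
      old : ∀ {u v} → (v ≡ ρ (suc s) ⊎ (∃ λ j → j < s × v ≡ ζ j)) → Far (e u) v
      old (inj₁ refl) = new (<⇒≤ s+1<2s) , λ q → oldρ (link (<⇒≤ s+1<2s) q)
      old (inj₂ (j , l , refl)) = ζfar l
      rung : ∀ {k v} → k < suc r → (v ≡ ρ (suc s) ⊎ (∃ λ j → j < s × v ≡ ζ j)) → Far (ρ k) v
      rung {k} l (inj₁ refl) = (λ p → <⇒≢ k<s+1 (InducedPath.inj path a b p)) , λ q → far (InducedPath.chord path a b q)
        where
        k<s+1 : k < suc s
        k<s+1 = <-trans l (s≤s (n≤1+n (suc r)))
        a : k < suc (s + s)
        a = <-trans k<s+1 (s≤s (<⇒≤ s+1<2s))
        b : suc s < suc (s + s)
        b = s≤s (<⇒≤ s+1<2s)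
        far : ¬ Near k (suc s)
        far (inj₁ p) = <⇒≢ (<-trans l (n<1+n _)) (suc-injective p)
        far (inj₂ p) = <⇒≢ (<-trans k<s+1 (n<1+n _)) (sym p)
      rung {k} l (inj₂ (j , l' , refl)) = ρ≢ζ k≤ l' , λ q → far (ζlink k≤ l' q)
        where
        k≤ : k ≤ s + s
        k≤ = ≤-trans (<⇒≤ (<-trans l (n<1+n _))) s≤2s
        far : ¬ ((suc k ≡ s × j ≡ 0) ⊎ (k ≡ suc s × suc j ≡ s))
        far (inj₁ (p , _)) = <⇒≢ l (suc-injective p)
        far (inj₂ (p , _)) = <⇒≢ (<-trans l (s≤s (n≤1+n (suc r)))) p
      apart : ∀ i j → F.f i ≢ ρ (suc r) → F.f i ≢ ρ s → P.f j ≢ ρ (suc r) → P.f j ≢ ρ s → Far (F.f i) (P.f j)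
      apart i j a b c d with P.vertex j
      ... | inj₁ (inj₁ p) = ⊥-elim (c p)
      ... | inj₁ (inj₂ p) = ⊥-elim (d p)
      ... | inj₂ v with F.vertex i
      ...   | inj₁ (inj₁ p) = subst (λ w → Far w (P.f j)) (sym p) (old v)
      ...   | inj₁ (inj₂ p) = subst (λ w → Far w (P.f j)) (sym p) (old v)
      ...   | inj₂ (k , l , p) with m≤n⇒m<n∨m≡n l
      ...     | inj₂ q = ⊥-elim (b (trans p (cong ρ q)))
      ...     | inj₁ (s≤s l') with m≤n⇒m<n∨m≡n l'
      ...       | inj₂ q = ⊥-elim (a (trans p (cong ρ q)))
      ...       | inj₁ l'' = subst (λ w → Far w (P.f j)) (sym p) (rung l'' v)

-- The territories T_m

-- The index is only an upper bound on the number of edges: `stay` is available at every index, so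
-- estimates can be weakened freely.
data Within {A : Set} (R : Rel A) : ℕ → A → A → Set where
  stay : ∀ {n x} → Within R n x x
  move : ∀ {n x y z} → R x y → Within R n y z → Within R (suc n) x z

module _ {A : Set} {R : Rel A} where

  within-≤ : ∀ {n m x y} → n ≤ m → Within R n x y → Within R m x y
  within-≤ l stay = stay
  within-≤ (s≤s l) (move r w) = move r (within-≤ l w)

  within-trans : ∀ {n m x y z} → Within R n x y → Within R m y z → Within R (n + m) x z
  within-trans {n} {m} stay w = within-≤ (m≤n+m m n) w
  within-trans (move r v) w = move r (within-trans v w)

  within-sym : Sym R → ∀ {n x y} → Within R n x y → Within R n y x
  within-sym sy stay = stay
  within-sym sy {suc n} (move r w) = within-≤ (≤-reflexive (+-comm n 1)) (within-trans (within-sym sy w) (move (sy r) stay))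

  within-walk : (c : ℕ → A) → ∀ a n → (∀ {k} → k < a + n → a ≤ k → R (c k) (c (suc k))) → Within R n (c a) (c (a + n))
  within-walk c a zero f = subst (λ z → Within R 0 (c a) (c z)) (sym (+-identityʳ a)) stay
  within-walk c a (suc n) f = move (f (m<m+n a (s≤s z≤n)) ≤-refl)
    (subst (λ z → Within R n (c (suc a)) (c z)) (sym (+-suc a n))
      (within-walk c (suc a) n (λ l l' → f (≤-trans l (≤-reflexive (sym (+-suc a n)))) (≤-trans (n≤1+n a) l'))))

within-bind : {A B : Set} {R : Rel A} {S : Rel B} (f : A → B) → ∀ {d} → (∀ {x y} → R x y → Within S d (f x) (f y)) →
              ∀ {n x y} → Within R n x y → Within S (n * d) (f x) (f y)
within-bind f g stay = stay
within-bind f g (move r w) = within-trans (g r) (within-bind f g w)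

delete-swap-cycle : {A : Set} {R : Rel A} → ∀ {p u v} → HasInducedCycle (DeleteEdge R u v) p → HasInducedCycle (DeleteEdge R v u) p
delete-swap-cycle {R = R} (f , i , a) = f , i , λ x y → mk⇔ (Equivalence.to (a x y) ∘ Delete-swap {R = R}) (Delete-swap {R = R} ∘ Equivalence.from (a x y))

two-apart : ∀ {p} {{_ : NonZero p}} → 5 ≤ p → ∀ {i j k} → Next p i j → Next p j k → i ≢ k × ¬ CycAdj p i k
two-apart {p} 5≤p {i} {j} {k} n n' = subst₂ (λ a c → a ≢ c × ¬ CycAdj p a c) at0 at2
    ((λ e → 0≢2 (W.inj 0<p 2<p e)) , λ e → far (W.chord 0<p 2<p e))
  where
  module W = InducedCycle (window {R = CycAdj p} {f = λ i → i} Sum.swap ((λ e → e) , λ i j → mk⇔ (λ x → x) (λ x → x)) (toℕ i))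
  0<p : 0 < p
  0<p = ≤-trans (s≤s z≤n) 5≤p
  2<p : 2 < p
  2<p = ≤-trans (s≤s (s≤s (s≤s z≤n))) 5≤p
  0≢2 : 0 ≢ 2
  0≢2 ()
  at0 : (toℕ i + 0) mod p ≡ i
  at0 = trans (cong (_mod p) (+-identityʳ (toℕ i))) (mod-toℕ i)
  at1 : suc (toℕ i) mod p ≡ j
  at1 = Next⇒mod (subst (λ z → Next p z j) (sym (mod-toℕ i)) n)
  at2 : (toℕ i + 2) mod p ≡ k
  at2 = trans (cong (_mod p) (+-comm (toℕ i) 2)) (Next⇒mod (subst (λ z → Next p z k) (sym at1) n'))
  far : ¬ (Near 0 2 ⊎ Ends p 0 2)
  far (inj₁ (inj₁ ()))
  far (inj₁ (inj₂ ()))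
  far (inj₂ (inj₁ (_ , e))) = <⇒≢ (≤-trans (s≤s (s≤s (s≤s (s≤s z≤n)))) 5≤p) e
  far (inj₂ (inj₂ (_ , ())))

module _ (r : ℕ) where

  private
    s t : ℕ
    s = 2 + r
    t = 5 + r

  -- shadow u is the boundary position met by following rungs outwards from u, through depth u layers;
  -- crossing an edge at depth k moves it by at most (t - 3)^k.
  record Territory (O : OTerr) : Set where
    field
      symmetric   : Sym (OE O)
      irreflexive : ∀ {u} → ¬ OE O u u
      boundary    : IsInducedCycle (OE O) (len O) (bd O)
      5≤len       : 5 ≤ len O
      face        : ∀ {i j} → Next (len O) i j → Face (OE O) t (bd O i) (bd O j)
      edge        : ∀ {u v} → OE O u v → HasInducedCycle (DeleteEdge (OE O) u v) (4 + (s + s))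
                    ⊎ (∃ λ i → ∃ λ j → Next (len O) i j × ((u ≡ bd O i × v ≡ bd O j) ⊎ (u ≡ bd O j × v ≡ bd O i)))
      shadow      : OV O → Fin (len O)
      depth       : OV O → ℕ
      shadow-bd   : ∀ i → shadow (bd O i) ≡ i
      depth-bd    : ∀ i → depth (bd O i) ≡ 0
      lipschitz   : ∀ {u v k} → OE O u v → depth u ≤ k →
                    Within (CycAdj (len O)) (s ^ k) (shadow u) (shadow v) × depth v ≤ suc k

  base : Territory (Tm t 0)
  base = record
    { symmetric = Sum.swap
    ; irreflexive = [ irr , irr ]′
    ; boundary = (λ e → e) , λ i j → mk⇔ (λ x → x) (λ x → x)
    ; 5≤len = s≤s (s≤s (s≤s (s≤s (s≤s z≤n))))
    ; face = λ {i} {j} n → (λ i → i) , ((λ e → e) , λ i j → mk⇔ (λ x → x) (λ x → x)) , (i , refl) , (j , refl)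
    ; edge = λ { (inj₁ n) → inj₂ (_ , _ , n , inj₁ (refl , refl)) ; (inj₂ n) → inj₂ (_ , _ , n , inj₂ (refl , refl)) }
    ; shadow = λ i → i
    ; depth = λ _ → 0
    ; shadow-bd = λ _ → refl
    ; depth-bd = λ _ → refl
    ; lipschitz = λ {_} {_} {k} a _ → within-≤ (m^n>0 s k) (move a stay) , z≤n }
    where
    irr : ∀ {i : Fin t} → ¬ Next t i i
    irr (inj₁ e) = 1+n≢n e
    irr (inj₂ (e , z)) with trans (cong suc (sym z)) e
    ... | ()

  module Layer (m : ℕ) (T : Territory (Tm t m)) where
    open Territory T

    O N : OTerr
    O = Tm t m
    N = Tm t (suc m)
    p L : ℕ
    p = len O
    L = p * s

    instance
      p≢0 : NonZero p
      p≢0 = >-nonZero (≤-trans (s≤s z≤n) 5≤len)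
    -- The 2s + 1 ring vertices of a ladder must leave out part of the ring; otherwise they would
    -- close up instead of forming an induced path.
    2+2s≤L : 2 + (s + s) ≤ L
    2+2s≤L = ≤-trans (≤-trans (+-monoˡ-≤ (s + s) (s≤s (s≤s z≤n))) (+-monoʳ-≤ s (+-monoʳ-≤ s (m≤m+n s _))))
                     (*-monoˡ-≤ s 5≤len)
    instance
      L≢0 : NonZero L
      L≢0 = >-nonZero (≤-trans (s≤s z≤n) 2+2s≤L)

    symN : Sym (OE N)
    symN {inj₁ _} {inj₁ _} e = symmetric e
    symN {inj₁ _} {inj₂ _} e = e
    symN {inj₂ _} {inj₁ _} e = e
    symN {inj₂ _} {inj₂ _} e = Sum.swap e

    irrN : ∀ {u} → ¬ OE N u u
    irrN {inj₁ _} e = irreflexive e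
    irrN {inj₂ q} = [ irr , irr ]′
      where
      irr : ∀ {i : Fin L} → ¬ Next L i i
      irr (inj₁ e) = 1+n≢n e
      irr (inj₂ (e , z)) = <⇒≢ (≤-trans (s≤s (s≤s z≤n)) 2+2s≤L) (trans (cong suc (sym z)) e)

    embed : Embedding (OE O) (OE N) inj₁
    embed = record { symO = symmetric ; irrO = irreflexive ; symR = λ {a} {b} → symN {a} {b} ; inject = λ { refl → refl } ; emb→ = λ e → e ; emb← = λ e → e }

    ring : IsInducedCycle (OE N) L inj₂
    ring = (λ { refl → refl }) , λ i j → mk⇔ (λ x → x) (λ x → x)

    rim : ℕ → ℕ → OV O
    rim J k = bd O ((J + k) mod p)

    *-% : ∀ a → (a * s) % L ≡ a % p * s
    *-% a = sym (m%n*o≡m*o%[n*o] a p s)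

    link-at : ∀ {u q} → (k : ℕ) → u ≡ bd O (k mod p) → q ≡ (k * s) mod L → OE N (inj₁ u) (inj₂ q)
    link-at k e refl = k mod p , e , trans (toℕ-mod (k * s)) (trans (*-% k) (cong (_* s) (sym (toℕ-mod k))))

    -- The strip between the old boundary vertices J, J + 1, J + 2 and the ring from position J * s
    -- to (J + 2) * s. As `J` is an unreduced natural number, strips across the end of the listing
    -- need no separate case.
    ladder : ℕ → Ladder (OE O) (OE N) inj₁ s
    ladder J = record
      { ρ = ρ ; x = rim J 0 ; y = rim J 1 ; z = rim J 2
      ; xy = Equivalence.from (proj₂ boundary _ _) (inj₁ (nx 0))
      ; yz = Equivalence.from (proj₂ boundary _ _) (inj₁ (nx 1))
      ; x≁z = proj₂ ap ∘ Equivalence.to (proj₂ boundary _ _)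
      ; x≢z = proj₁ ap ∘ proj₁ boundary
      ; path = prefix 2+2s≤L (window {R = OE N} {f = inj₂} (λ {a} {b} → symN {a} {b}) ring (J * s))
      ; new = λ _ ()
      ; link = lk
      ; linkx = link-at (J + 0) refl (cong (_mod L) (trans (+-identityʳ (J * s)) (cong (_* s) (sym (+-identityʳ J)))))
      ; linky = link-at (J + 1) refl (cong (_mod L) (trans (+-comm (J * s) s) (cong (_* s) (+-comm 1 J))))
      ; linkz = link-at (J + 2) refl (cong (_mod L) (trans (+-comm (J * s) (s + s)) (trans (+-assoc s s (J * s)) (cong (_* s) (+-comm 2 J)))))
      }
      where
      ρ : ℕ → OV N
      ρ k = inj₂ ((J * s + k) mod L)
      nx : ∀ k → Next p ((J + k) mod p) ((J + suc k) mod p)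
      nx k = subst (λ z → Next p ((J + k) mod p) (z mod p)) (sym (+-suc J k)) (Next-mod (J + k))
      ap : (J + 0) mod p ≢ (J + 2) mod p × ¬ CycAdj p ((J + 0) mod p) ((J + 2) mod p)
      ap = two-apart 5≤len (nx 0) (nx 1)
      at : ∀ {u j'} i → u ≡ bd O j' → toℕ ((J * s + i * s) mod L) ≡ toℕ j' * s → u ≡ rim J i
      at {u} {j'} i e q = trans e (cong (bd O) (toℕ-injective (*-cancelʳ-≡ _ _ s (begin
          toℕ j' * s                  ≡⟨ q ⟨
          toℕ ((J * s + i * s) mod L) ≡⟨ toℕ-mod (J * s + i * s) ⟩
          (J * s + i * s) % L         ≡⟨ cong (_% L) (*-distribʳ-+ s J i) ⟨
          ((J + i) * s) % L           ≡⟨ *-% (J + i) ⟩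
          (J + i) % p * s             ≡⟨ cong (_* s) (toℕ-mod (J + i)) ⟨
          toℕ ((J + i) mod p) * s     ∎))))
        where open ≡-Reasoning
      mult : ∀ {k} → k ≤ s + s → ∀ i → k ≡ i * s → (i ≡ 0) ⊎ (i ≡ 1) ⊎ (i ≡ 2)
      mult l 0 _ = inj₁ refl
      mult l 1 _ = inj₂ (inj₁ refl)
      mult l 2 _ = inj₂ (inj₂ refl)
      mult l (suc (suc (suc i))) e = ⊥-elim (<⇒≱ (s≤s z≤n) (+-cancelˡ-≤ s _ _ (+-cancelˡ-≤ s _ _
        (≤-trans (≤-reflexive (sym e)) (≤-trans l (≤-reflexive (cong (s +_) (sym (+-identityʳ s)))))))))
      lk : ∀ {u k} → k ≤ s + s → OE N (inj₁ u) (ρ k) → (k ≡ 0 × u ≡ rim J 0) ⊎ (k ≡ s × u ≡ rim J 1) ⊎ (k ≡ s + s × u ≡ rim J 2)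
      lk {u} {k} l (j' , e , q) = go (mult l i k≡)
        where
        -- Both `J * s` and the ring length are multiples of `s`, and rungs end at multiples of `s`;
        -- together with `k ≤ s + s` only 0, s and 2s remain.
        s∣k : s ∣ k
        s∣k = ∣m+n∣m⇒∣n {m = J * s} (∣n∣m%n⇒∣m (n∣m*n p) (divides (toℕ j') (trans (sym (toℕ-mod (J * s + k))) q))) (n∣m*n J)
        i : ℕ
        i = _∣_.quotient s∣k
        k≡ : k ≡ i * s
        k≡ = _∣_.equality s∣k
        u≡ : u ≡ rim J i
        u≡ = at i e (trans (cong (λ z → toℕ ((J * s + z) mod L)) (sym k≡)) q)
        go : (i ≡ 0) ⊎ (i ≡ 1) ⊎ (i ≡ 2) → _
        go (inj₁ z) = inj₁ (trans k≡ (cong (_* s) z) , trans u≡ (cong (rim J) z))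
        go (inj₂ (inj₁ z)) = inj₂ (inj₁ (trans k≡ (trans (cong (_* s) z) (+-identityʳ s)) , trans u≡ (cong (rim J) z)))
        go (inj₂ (inj₂ z)) = inj₂ (inj₂ (trans k≡ (trans (cong (_* s) z) (cong (s +_) (+-identityʳ s))) , trans u≡ (cong (rim J) z)))

    private
      1≤s : 1 ≤ s
      1≤s = s≤s z≤n

    -- Dividing the position by `s` selects the strip: for the quotient `J` the remainder is below
    -- `s`, so the ring edge lies in the left half of ladder `J`.
    faceN : ∀ {i j} → Next L i j → Face (OE N) t (inj₂ i) (inj₂ j)
    faceN {i} {j} n = subst₂ (Face (OE N) t) (cong inj₂ at-i) (cong inj₂ at-j) (face-ρ embed 1≤s (ladder J) (m%n<n q s))
      where
      q = toℕ i
      J = q / s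
      k = q % s
      q≡ : J * s + k ≡ q
      q≡ = trans (+-comm (J * s) k) (sym (m≡m%n+[m/n]*n q s))
      at-i : (J * s + k) mod L ≡ i
      at-i = trans (cong (_mod L) q≡) (mod-toℕ i)
      at-j : (J * s + suc k) mod L ≡ j
      at-j = trans (cong (_mod L) (trans (+-suc (J * s) k) (cong suc q≡))) (Next⇒mod (subst (λ z → Next L z j) (sym (mod-toℕ i)) n))

    rim-0 : ∀ i → rim (toℕ i) 0 ≡ bd O i
    rim-0 i = cong (bd O) (trans (cong (_mod p) (+-identityʳ (toℕ i))) (mod-toℕ i))
    rim-1 : ∀ {i j} → Next p i j → rim (toℕ i) 1 ≡ bd O j
    rim-1 {i} n = cong (bd O) (trans (cong (_mod p) (+-comm (toℕ i) 1)) (Next⇒mod (subst (λ z → Next p z _) (sym (mod-toℕ i)) n)))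

    rung : ∀ {u q} → OE N (inj₁ u) (inj₂ q) → HasInducedCycle (DeleteEdge (OE N) (inj₁ u) (inj₂ q)) (4 + (s + s))
    rung {u} {q} (j , e , q≡) = subst₂ (λ a b → HasInducedCycle (DeleteEdge (OE N) (inj₁ a) (inj₂ b)) (4 + (s + s))) at-u at-q (good-rung embed 1≤s (ladder J))
      where
      -- This is j - 1 modulo `p`, which makes `j` the middle vertex of the ladder.
      J = toℕ j + pred p
      J+1 : J + 1 ≡ toℕ j + p
      J+1 = trans (+-assoc (toℕ j) (pred p) 1) (cong (toℕ j +_) (trans (+-comm (pred p) 1) (suc-pred p)))
      J% : (J + 1) % p ≡ toℕ j
      J% = trans (cong (_% p) J+1) (trans ([m+n]%n≡m%n (toℕ j) p) (m<n⇒m%n≡m (toℕ<n j)))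
      at-u : rim J 1 ≡ u
      at-u = trans (cong (bd O) (toℕ-injective (trans (toℕ-mod (J + 1)) J%))) (sym e)
      at-q : (J * s + s) mod L ≡ q
      at-q = toℕ-injective (begin
        toℕ ((J * s + s) mod L) ≡⟨ toℕ-mod (J * s + s) ⟩
        (J * s + s) % L         ≡⟨ cong (_% L) (trans (+-comm (J * s) s) (cong (_* s) (+-comm 1 J))) ⟩
        ((J + 1) * s) % L       ≡⟨ *-% (J + 1) ⟩
        (J + 1) % p * s         ≡⟨ cong (_* s) J% ⟩
        toℕ j * s               ≡⟨ q≡ ⟨
        toℕ q                   ∎)
        where open ≡-Reasoning

    Outcome : Rel (OV N)
    Outcome u v = HasInducedCycle (DeleteEdge (OE N) u v) (4 + (s + s))
                  ⊎ (∃ λ i → ∃ λ j → Next L i j × ((u ≡ inj₂ i × v ≡ inj₂ j) ⊎ (u ≡ inj₂ j × v ≡ inj₂ i)))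

    good-rim : ∀ {i j} → Next p i j → HasInducedCycle (DeleteEdge (OE N) (inj₁ (bd O i)) (inj₁ (bd O j))) (4 + (s + s))
    good-rim {i} {j} n = subst₂ (λ a b → HasInducedCycle (DeleteEdge (OE N) (inj₁ a) (inj₁ b)) (4 + (s + s))) (rim-0 i) (rim-1 n)
      (good-xy embed 1≤s (ladder (toℕ i)) (subst₂ (Face (OE O) t) (sym (rim-0 i)) (sym (rim-1 n)) (face n)))

    edgeN : ∀ {u v} → OE N u v → Outcome u v
    edgeN {inj₁ u} {inj₁ v} e with edge e
    ... | inj₁ g = inj₁ (liftDelete embed g)
    ... | inj₂ (i , j , n , inj₁ (refl , refl)) = inj₁ (good-rim n)
    ... | inj₂ (i , j , n , inj₂ (refl , refl)) = inj₁ (delete-swap-cycle {R = OE N} (good-rim n))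
    edgeN {inj₁ u} {inj₂ q} e = inj₁ (rung e)
    edgeN {inj₂ q} {inj₁ u} e = inj₁ (delete-swap-cycle {R = OE N} (rung e))
    edgeN {inj₂ _} {inj₂ _} (inj₁ n) = inj₂ (_ , _ , n , inj₁ (refl , refl))
    edgeN {inj₂ _} {inj₂ _} (inj₂ n) = inj₂ (_ , _ , n , inj₂ (refl , refl))

    scale : Fin p → Fin L
    scale j = (toℕ j * s) mod L

    -- One boundary step of the previous layer becomes a subdivided edge of `s` steps. Iterated over
    -- the layers, this produces the powers of `s` in `lipschitz`.
    scale-next : ∀ {i j} → Next p i j → Within (CycAdj L) s (scale i) (scale j)
    scale-next {i} {j} n = subst (Within (CycAdj L) s (scale i)) arrive
      (within-walk (_mod L) (toℕ i * s) s (λ {k} _ _ → inj₁ (Next-mod k)))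
      where
      arrive : (toℕ i * s + s) mod L ≡ scale j
      arrive = mod-cong (begin
        (toℕ i * s + s) % L   ≡⟨ cong (_% L) (+-comm (toℕ i * s) s) ⟩
        (suc (toℕ i) * s) % L ≡⟨ *-% (suc (toℕ i)) ⟩
        suc (toℕ i) % p * s   ≡⟨ cong (_* s) (Next⇒% n) ⟩
        toℕ j * s             ≡⟨ cong (_* s) (m<n⇒m%n≡m (toℕ<n j)) ⟨
        toℕ j % p * s         ≡⟨ *-% (toℕ j) ⟨
        (toℕ j * s) % L       ∎)
        where open ≡-Reasoning

    scale-adj : ∀ {i j} → CycAdj p i j → Within (CycAdj L) s (scale i) (scale j)
    scale-adj (inj₁ n) = scale-next n
    scale-adj (inj₂ n) = within-sym Sum.swap (scale-next n)

    shadowN : OV N → Fin L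
    shadowN (inj₁ u) = scale (shadow u)
    shadowN (inj₂ q) = q

    depthN : OV N → ℕ
    depthN (inj₁ u) = suc (depth u)
    depthN (inj₂ q) = 0

    shadow-link : ∀ {u q} → OE N (inj₁ u) (inj₂ q) → scale (shadow u) ≡ q
    shadow-link {q = q} (j , refl , e) = trans (cong scale (shadow-bd j)) (trans (cong (_mod L) (sym e)) (mod-toℕ q))

    lipschitzN : ∀ {u v k} → OE N u v → depthN u ≤ k → Within (CycAdj L) (s ^ k) (shadowN u) (shadowN v) × depthN v ≤ suc k
    lipschitzN {inj₁ u} {inj₁ v} {suc k} e (s≤s l) =
      let w , d = lipschitz e l in within-≤ (≤-reflexive (*-comm (s ^ k) s)) (within-bind scale scale-adj w) , s≤s d
    lipschitzN {inj₁ u} {inj₂ q} {k} e l = subst (Within (CycAdj L) (s ^ k) _) (shadow-link e) stay , z≤n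
    lipschitzN {inj₂ q} {inj₁ u} {k} e l = subst (λ z → Within (CycAdj L) (s ^ k) z _) (shadow-link e) stay
      , s≤s (subst (_≤ k) (sym (trans (cong depth (proj₁ (proj₂ e))) (depth-bd (proj₁ e)))) z≤n)
    lipschitzN {inj₂ _} {inj₂ _} {k} e l = within-≤ (m^n>0 s k) (move e stay) , z≤n

    next : Territory N
    next = record
      { symmetric = λ {a} {b} → symN {a} {b} ; irreflexive = λ {a} → irrN {a} ; boundary = ring
      ; 5≤len = ≤-trans 5≤len (≤-trans (≤-reflexive (sym (*-identityʳ p))) (*-monoʳ-≤ p (s≤s z≤n)))
      ; face = faceN ; edge = λ {a} {b} → edgeN {a} {b} ; shadow = shadowN ; depth = depthN ; shadow-bd = λ _ → refl ; depth-bd = λ _ → refl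
      ; lipschitz = λ {a} {b} → lipschitzN {a} {b} }

  territory : ∀ m → Territory (Tm t m)
  territory zero = base
  territory (suc m) = Layer.next m (territory m)

-- Expansions

face-swap : {A : Set} {R : Rel A} → ∀ {t u v} → Face R t u v → Face R t v u
face-swap (f , F , a , b) = f , F , b , a

flap-length : ∀ r → 2 * (5 + r) ∸ 5 ≡ suc (2 + r + (2 + r))
flap-length r = begin
  r + (5 + (r + 0))   ≡⟨ cong (λ z → r + (5 + z)) (+-identityʳ r) ⟩
  r + (3 + (2 + r))   ≡⟨ +-assoc r 3 (2 + r) ⟨
  r + 3 + (2 + r)     ≡⟨ cong (_+ (2 + r)) (+-comm r 3) ⟩
  3 + r + (2 + r)     ∎
  where open ≡-Reasoning

-- an upper bound for walks along R_i inside the new boundary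
flapWalk : ℕ → ℕ
flapWalk r = (2 + r + (2 + r)) + (1 + (suc r + (1 + suc r)))

-- Abstract because unfolding the power makes conversion checking explode.
abstract
  spread : ℕ → ℕ → ℕ
  spread r n = flapWalk r + (n * (2 + r) ^ n * suc (flapWalk r) + flapWalk r)

  spread-def : ∀ r n → spread r n ≡ flapWalk r + (n * (2 + r) ^ n * suc (flapWalk r) + flapWalk r)
  spread-def r n = refl

module ExpandedTerritory (r : ℕ) (O : OTerr) (Ty : Territory r O) (d : ExpData (5 + r) O) where

  private
    s t : ℕ
    s = 2 + r
    t = 5 + r

  open Territory Ty
  open ExpData d
  open Expansion t O d

  private
    instance
      p≢0 : NonZero p
      p≢0 = >-nonZero (≤-trans (s≤s z≤n) 5≤len)
    lenP : 2 * t ∸ 5 ≡ suc (s + s)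
    lenP = flap-length r
    lastP : 2 * t ∸ 6 ≡ s + s
    lastP = cong pred lenP
    instance
      P≢0 : NonZero (2 * t ∸ 5)
      P≢0 = subst NonZero (sym lenP) _
    s<2s : s < s + s
    s<2s = m<m+n s (s≤s z≤n)
    ss<s+s : suc s ≤ s + s
    ss<s+s = s<2s

  Flap : Fin p → Set
  Flap i = T (X i)

  P : ∀ {i} → Flap i → ℕ → EV
  P {i} f k = inj₂ (inj₁ ((i , f) , k mod (2 * t ∸ 5)))

  Q : ∀ {i} → T (I i) → ℕ → EV
  Q {i} f k = inj₂ (inj₂ ((i , f) , k mod s))

  P-index : ∀ {k} → k ≤ s + s → toℕ (k mod (2 * t ∸ 5)) ≡ k
  P-index {k} l = trans (toℕ-mod k) (m<n⇒m%n≡m (subst (k <_) (sym lenP) (s≤s l)))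

  Q-index : ∀ {k} → k < s → toℕ (_mod_ k s) ≡ k
  Q-index {k} l = trans (toℕ-mod k) (m<n⇒m%n≡m l)

  P-vertex : ∀ {i} (f : Flap i) q → inj₂ (inj₁ ((i , f) , q)) ≡ P f (toℕ q)
  P-vertex {i} f q = cong (λ z → inj₂ (inj₁ ((i , f) , z))) (sym (mod-toℕ q))

  Q-vertex : ∀ {i} (f : T (I i)) q → inj₂ (inj₂ ((i , f) , q)) ≡ Q f (toℕ q)
  Q-vertex {i} f q = cong (λ z → inj₂ (inj₂ ((i , f) , z))) (sym (mod-toℕ q))

  P≤ : ∀ (q : Fin (2 * t ∸ 5)) → toℕ q ≤ s + s
  P≤ q = s≤s⁻¹ (subst (toℕ q <_) lenP (toℕ<n q))

  EE-sym : Sym EE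
  EE-sym = Sum.swap

  embed : Embedding (OE O) EE inj₁
  embed = record { symO = symmetric ; irrO = irreflexive ; symR = λ {a} {c} → EE-sym {a} {c} ; inject = λ { refl → refl } ; emb→ = inj₁ ; emb← = [ (λ e → e) , symmetric ]′ }

  pre post : Fin p → Fin p
  pre i = (toℕ i + pred p) mod p
  post i = suc (toℕ i) mod p

  next-post : ∀ i → Next p i (post i)
  next-post i = subst (λ z → Next p z (post i)) (mod-toℕ i) (Next-mod (toℕ i))

  next-pre : ∀ i → Next p (pre i) i
  next-pre i = subst (Next p (pre i)) e (Next-mod (toℕ i + pred p))
    where
    e : suc (toℕ i + pred p) mod p ≡ i
    e = trans (mod-cong {p} {{p≢0}} {suc (toℕ i + pred p)} {toℕ i} (trans (cong (_% p) (trans (sym (+-suc (toℕ i) (pred p))) (cong (toℕ i +_) (suc-pred p)))) ([m+n]%n≡m%n (toℕ i) p))) (mod-toℕ i)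

  adjacent : ∀ {i j} → CycAdj p i j → OE O (b i) (b j)
  adjacent = Equivalence.from (proj₂ boundary _ _)

  P-edge : ∀ {i} (f : Flap i) {k} → suc k ≤ s + s → EE (P f k) (P f (suc k))
  P-edge f {k} l = inj₁ (refl , trans (cong suc (P-index (≤-trans (n≤1+n k) l))) (sym (P-index l)))

  Q-edge : ∀ {i} (f : T (I i)) {k} → suc k < s → EE (Q f k) (Q f (suc k))
  Q-edge f {k} l = inj₁ (refl , trans (cong suc (Q-index (<-trans (n<1+n k) l))) (sym (Q-index l)))

  ladder : ∀ {i} → Flap i → Ladder (OE O) EE inj₁ s
  ladder {i} f = record
    { ρ = P f ; x = b (pre i) ; y = b i ; z = b (post i)
    ; xy = adjacent (inj₁ (next-pre i))
    ; yz = adjacent (inj₁ (next-post i))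
    ; x≁z = proj₂ ap ∘ Equivalence.to (proj₂ boundary _ _)
    ; x≢z = proj₁ ap ∘ proj₁ boundary
    ; path = record { inj = pinj ; step = λ { (s≤s l) → P-edge f l } ; chord = pchord }
    ; new = λ _ ()
    ; link = lk
    ; linkx = inj₁ (inj₁ (pre i , next-pre i , refl , P-index z≤n))
    ; linky = inj₁ (inj₂ (inj₁ (refl , P-index (m≤m+n s s))))
    ; linkz = inj₁ (inj₂ (inj₂ (post i , next-post i , refl , trans (P-index ≤-refl) (sym lastP)))) }
    where
    ap : pre i ≢ post i × ¬ CycAdj p (pre i) (post i)
    ap = two-apart 5≤len (next-pre i) (next-post i)
    index : EV → ℕ
    index (inj₂ (inj₁ (_ , q))) = toℕ q
    index _ = 0
    pinj : ∀ {k k'} → k < suc (s + s) → k' < suc (s + s) → P f k ≡ P f k' → k ≡ k'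
    pinj (s≤s l) (s≤s l') e = trans (sym (P-index l)) (trans (cong index e) (P-index l'))
    pchord : ∀ {k k'} → k < suc (s + s) → k' < suc (s + s) → EE (P f k) (P f k') → Near k k'
    pchord (s≤s l) (s≤s l') (inj₁ (_ , e)) = inj₁ (trans (cong suc (sym (P-index l))) (trans e (P-index l')))
    pchord (s≤s l) (s≤s l') (inj₂ (_ , e)) = inj₂ (trans (cong suc (sym (P-index l'))) (trans e (P-index l)))
    lk : ∀ {u k} → k ≤ s + s → EE (inj₁ u) (P f k) → (k ≡ 0 × u ≡ b (pre i)) ⊎ (k ≡ s × u ≡ b i) ⊎ (k ≡ s + s × u ≡ b (post i))
    lk l (inj₁ (inj₁ (j , n , e , q))) = inj₁ (trans (sym (P-index l)) q , trans e (cong b (Next-unique⁻ n (next-pre i))))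
    lk l (inj₁ (inj₂ (inj₁ (e , q)))) = inj₂ (inj₁ (trans (sym (P-index l)) q , e))
    lk l (inj₁ (inj₂ (inj₂ (j , n , e , q)))) = inj₂ (inj₂ (trans (sym (P-index l)) (trans q lastP) , trans e (cong b (Next-unique n (next-post i)))))

  PQ-first : ∀ {i} (f : Flap i) (g : T (I i)) → EE (P f (suc r)) (Q g 0)
  PQ-first f g = inj₁ (refl , inj₁ (P-index (≤-trans (n≤1+n (suc r)) (m≤m+n s s)) , Q-index (s≤s z≤n)))

  PQ-last : ∀ {i} (f : Flap i) (g : T (I i)) → EE (P f (suc s)) (Q g (suc r))
  PQ-last f g = inj₁ (refl , inj₂ (P-index ss<s+s , Q-index ≤-refl))

  pocket : ∀ {i} (f : Flap i) → T (I i) → Pocket (ladder f)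
  pocket {i} f g = record
    { ζ = Q g
    ; ζpath = record { inj = qinj ; step = Q-edge g ; chord = qchord }
    ; ζfar = λ _ → (λ ()) , λ { (inj₁ ()) ; (inj₂ ()) }
    ; ρ≢ζ = λ _ _ ()
    ; ζlink = lk
    ; ζfirst = λ { refl → PQ-first f g }
    ; ζlast = λ { refl → PQ-last f g } }
    where
    index : EV → ℕ
    index (inj₂ (inj₂ (_ , q))) = toℕ q
    index _ = 0
    qinj : ∀ {k k'} → k < s → k' < s → Q g k ≡ Q g k' → k ≡ k'
    qinj l l' e = trans (sym (Q-index l)) (trans (cong index e) (Q-index l'))
    qchord : ∀ {k k'} → k < s → k' < s → EE (Q g k) (Q g k') → Near k k'
    qchord l l' (inj₁ (_ , e)) = inj₁ (trans (cong suc (sym (Q-index l))) (trans e (Q-index l')))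
    qchord l l' (inj₂ (_ , e)) = inj₂ (trans (cong suc (sym (Q-index l'))) (trans e (Q-index l)))
    lk : ∀ {k j} → k ≤ s + s → j < s → EE (P f k) (Q g j) → (suc k ≡ s × j ≡ 0) ⊎ (k ≡ suc s × suc j ≡ s)
    lk l l' (inj₁ (_ , inj₁ (e , e'))) = inj₁ (cong suc (trans (sym (P-index l)) e) , trans (sym (Q-index l')) e')
    lk l l' (inj₁ (_ , inj₂ (e , e'))) = inj₂ (trans (sym (P-index l)) e , cong suc (trans (sym (Q-index l')) e'))

  Good : EV → EV → Set
  Good u v = HasInducedCycle (DeleteEdge EE u v) (4 + (s + s))

  -- The second alternative is meant for edges of the new boundary: one face is known, and the other
  -- has to come from a different territory.
  Outcome : EV → EV → Set
  Outcome u v = Good u v ⊎ (inB u × inB v × Face EE t u v)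

  good-swap : ∀ {u v} → Good u v → Good v u
  good-swap = delete-swap-cycle {R = EE}

  outcome-swap : ∀ {u v} → Outcome u v → Outcome v u
  outcome-swap = Sum.map good-swap (λ (a , c , f) → c , a , face-swap {R = EE} f)

  private
    1≤s : 1 ≤ s
    1≤s = s≤s z≤n

  P-face : ∀ {i} (f : Flap i) {k} → suc k ≤ s + s → Face EE t (P f k) (P f (suc k))
  P-face f {k} l with suc k ≤? s
  ... | yes l' = face-ρ embed 1≤s (ladder f) l'
  ... | no l' = face-swap {R = EE} (subst₂ (λ a c → Face EE t (P f a) (P f c)) (m∸[m∸n]≡n l) back (face-ρ embed 1≤s (flip embed (ladder f)) k''<s))
    where
    k'' = s + s ∸ suc k
    e : suc k'' ≡ s + s ∸ k
    e = sym (+-∸-assoc 1 l)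
    back : s + s ∸ suc k'' ≡ k
    back = trans (cong (s + s ∸_) e) (m∸[m∸n]≡n (≤-trans (n≤1+n k) l))
    k''<s : suc k'' ≤ s
    k''<s = ≤-trans (≤-reflexive e) (≤-trans (∸-monoʳ-≤ (s + s) (s≤s⁻¹ (≰⇒> l'))) (≤-reflexive (m+n∸n≡m s s)))

  inB-P : ∀ {i} (f : Flap i) {k} → k ≤ s + s → ¬ (T (I i) × k ≡ s) → inB (P f k)
  inB-P f l n (g , e) = n (g , trans (sym (P-index l)) e)

  -- A flap at either end covers this edge with a second face and makes it interior. Without one,
  -- both ends and the old face survive.
  old-outcome : ∀ {i j} → Next p i j → Outcome (inj₁ (b i)) (inj₁ (b j))
  old-outcome {i} {j} n with T? (X i) | T? (X j)
  ... | yes f | _ = inj₁ (good-swap (subst (λ k → Good (inj₁ (b k)) (inj₁ (b i))) (Next-unique (next-post i) n)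
          (good-xy embed 1≤s (flip embed (ladder f)) (face-swap {R = OE O} (face (next-post i))))))
  ... | no _ | yes f = inj₁ (subst (λ k → Good (inj₁ (b k)) (inj₁ (b j))) (Next-unique⁻ (next-pre j) n)
          (good-xy embed 1≤s (ladder f) (face (next-pre j))))
  ... | no a | no c = inj₂ ((i , refl , a) , (j , refl , c) , liftFace embed (face n))

  -- Only the two edges at y_i, which has index `s`, can leave the boundary, and they do so exactly
  -- when Q_i is present; the pocket is then their second face.
  P-outcome : ∀ {i} (f : Flap i) {k} → suc k ≤ s + s → Outcome (P f k) (P f (suc k))
  P-outcome {i} f {k} l with T? (I i) | suc k ≟ s | k ≟ s
  ... | yes g | yes refl | _ = inj₁ (good-mid embed (ladder f) (pocket f g))
  ... | yes g | no _ | yes refl = inj₁ (good-swap (subst₂ (λ a c → Good (P f a) (P f c)) e (m+n∸n≡m s s)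
          (good-mid embed (flip embed (ladder f)) (flipPocket embed 1≤s (ladder f) (pocket f g)))))
    where
    e : s + s ∸ suc r ≡ suc s
    e = trans (cong (λ z → suc z ∸ suc r) (+-suc (suc r) (suc r))) (m+n∸n≡m (suc s) (suc r))
  ... | yes g | no a | no c = inj₂ (inB-P f (≤-trans (n≤1+n k) l) (c ∘ proj₂) , inB-P f l (a ∘ proj₂) , P-face f l)
  ... | no g | _ | _ = inj₂ (inB-P f (≤-trans (n≤1+n k) l) (g ∘ proj₁) , inB-P f l (g ∘ proj₁) , P-face f l)

  new-outcome : ∀ {u v} → D u v → Outcome u v
  new-outcome {inj₁ u} {inj₁ v} e with edge e
  ... | inj₁ g = inj₁ (liftDelete embed g)
  ... | inj₂ (i , j , n , inj₁ (refl , refl)) = old-outcome n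
  ... | inj₂ (i , j , n , inj₂ (refl , refl)) = outcome-swap (old-outcome n)
  new-outcome {inj₁ u} {inj₂ (inj₁ ((i , f) , q))} e = subst (Outcome (inj₁ u)) (sym (P-vertex f q)) (go e)
    where
    go : D (inj₁ u) (inj₂ (inj₁ ((i , f) , q))) → Outcome (inj₁ u) (P f (toℕ q))
    -- Stability of the chosen set guarantees that the neighbour x_i^- was not itself removed from
    -- the boundary.
    go (inj₁ (j , n , refl , e)) rewrite e = inj₂ ((j , refl , λ f' → stable j i (inj₁ n) f' f) , inB-P f z≤n (λ { (_ , ()) })
      , subst (λ k → Face EE t (inj₁ (b k)) (P f 0)) (Next-unique⁻ (next-pre i) n) (face-rung embed 1≤s (ladder f)))
    go (inj₂ (inj₁ (refl , e))) rewrite e = inj₁ (good-rung embed 1≤s (ladder f))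
    go (inj₂ (inj₂ (j , n , refl , e))) rewrite trans e lastP = inj₂ ((j , refl , λ f' → stable i j (inj₁ n) f f')
      , inB-P f ≤-refl (λ (_ , e) → <⇒≢ s<2s (sym e))
      , subst (λ k → Face EE t (inj₁ (b k)) (P f (s + s))) (Next-unique (next-post i) n) (face-rung embed 1≤s (flip embed (ladder f))))
  new-outcome {inj₂ (inj₁ ((i , f) , q))} {inj₂ (inj₁ ((.i , f') , q'))} (refl , e) =
    subst₂ Outcome (sym (P-vertex f q)) (sym (trans (cong (λ z → inj₂ (inj₁ ((i , z) , q'))) (T-irrelevant f' f)) (trans (P-vertex f q') (cong (P f) (sym e)))))
      (P-outcome f (subst (_≤ s + s) (sym e) (P≤ q')))
  new-outcome {inj₂ (inj₂ ((i , g) , q))} {inj₂ (inj₂ ((.i , g') , q'))} (refl , e) =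
    inj₂ (_ , _ , subst₂ (Face EE t) (sym (Q-vertex g q)) (sym (trans (cong (λ z → inj₂ (inj₂ ((i , z) , q'))) (T-irrelevant g' g)) (Q-vertex g q')))
      (F.f , F.induced , F.atζ (toℕ<n q) , F.atζ (toℕ<n q')))
    where module F = PocketFace (pocketFace embed (ladder (I⊆X i g)) (pocket (I⊆X i g) g))
  new-outcome {inj₂ (inj₁ ((i , f) , q))} {inj₂ (inj₂ ((.i , g) , q'))} (refl , e) =
    subst₂ Outcome (sym (P-vertex f q)) (sym (Q-vertex g q')) (go e)
    where
    module F = PocketFace (pocketFace embed (ladder f) (pocket f g))
    go : (toℕ q ≡ suc r × toℕ q' ≡ 0) ⊎ (toℕ q ≡ suc s × toℕ q' ≡ suc r) → Outcome (P f (toℕ q)) (Q g (toℕ q'))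
    go (inj₁ (e , e')) rewrite e | e' = inj₂ (inB-P f (≤-trans (n≤1+n (suc r)) (m≤m+n s s)) (λ (_ , e) → 1+n≢n (sym e)) , _
      , F.f , F.induced , F.atl , F.atζ (s≤s z≤n))
    go (inj₂ (e , e')) rewrite e | e' = inj₂ (inB-P f ss<s+s (λ (_ , e) → 1+n≢n e) , _
      , F.f , F.induced , F.atr , F.atζ ≤-refl)

  outcome : ∀ {u v} → EE u v → Outcome u v
  outcome (inj₁ e) = new-outcome e
  outcome (inj₂ e) = outcome-swap (new-outcome e)

  -- Distances along the new boundary

  Bound : EV → EV → Set
  Bound u v = EE u v × inB u × inB v

  Bound-sym : Sym Bound
  Bound-sym (e , a , c) = Sum.swap e , c , a

  -- Walks are first measured on the old boundary, where the `lipschitz` estimate is available; each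
  -- flap is collapsed to the index of the vertex that it replaces, so moving inside a flap costs
  -- nothing at this stage.
  foot : EV → Fin p
  foot (inj₁ u) = shadow u
  foot (inj₂ (inj₁ ((i , _) , _))) = i
  foot (inj₂ (inj₂ ((i , _) , _))) = i

  height : EV → ℕ
  height (inj₁ u) = depth u
  height (inj₂ _) = 0

  height-inB : ∀ {u} → inB u → height u ≡ 0
  height-inB {inj₁ u} (j , refl , _) = depth-bd j
  height-inB {inj₂ _} _ = refl

  private
    OldOrFlat : EV → EV → Set
    OldOrFlat u v = (∃ λ u' → ∃ λ v' → u ≡ inj₁ u' × v ≡ inj₁ v' × OE O u' v')
                    ⊎ (Within (CycAdj p) 1 (foot u) (foot v) × height u ≡ 0 × height v ≡ 0)

    classify : ∀ {u v} → D u v → OldOrFlat u v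
    classify {inj₁ u} {inj₁ v} e = inj₁ (u , v , refl , refl , e)
    classify {inj₁ u} {inj₂ (inj₁ _)} (inj₁ (j , n , refl , _)) =
      inj₂ (subst (λ z → Within (CycAdj p) 1 z _) (sym (shadow-bd j)) (move (inj₁ n) stay) , depth-bd j , refl)
    classify {inj₁ u} {inj₂ (inj₁ _)} (inj₂ (inj₁ (refl , _))) =
      inj₂ (subst (λ z → Within (CycAdj p) 1 z _) (sym (shadow-bd _)) stay , depth-bd _ , refl)
    classify {inj₁ u} {inj₂ (inj₁ _)} (inj₂ (inj₂ (j , n , refl , _))) =
      inj₂ (subst (λ z → Within (CycAdj p) 1 z _) (sym (shadow-bd j)) (move (inj₂ n) stay) , depth-bd j , refl)
    classify {inj₂ (inj₁ _)} {inj₂ (inj₁ _)} (refl , _) = inj₂ (stay , refl , refl)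
    classify {inj₂ (inj₁ _)} {inj₂ (inj₂ _)} (refl , _) = inj₂ (stay , refl , refl)
    classify {inj₂ (inj₂ _)} {inj₂ (inj₂ _)} (refl , _) = inj₂ (stay , refl , refl)

    classify-sym : ∀ {u v} → OldOrFlat u v → OldOrFlat v u
    classify-sym (inj₁ (a , c , e , e' , o)) = inj₁ (c , a , e' , e , symmetric o)
    classify-sym (inj₂ (w , a , c)) = inj₂ (within-sym Sum.swap w , c , a)

    flatten : ∀ {u v k} → OldOrFlat u v → height u ≤ k → Within (CycAdj p) (s ^ k) (foot u) (foot v) × height v ≤ suc k
    flatten (inj₁ (a , c , refl , refl , e)) l = lipschitz e l
    flatten {k = k} (inj₂ (w , a , c)) l = within-≤ (m^n>0 s k) w , subst (_≤ suc k) (sym c) z≤n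

  foot-lipschitz : ∀ {u v k} → EE u v → height u ≤ k → Within (CycAdj p) (s ^ k) (foot u) (foot v) × height v ≤ suc k
  foot-lipschitz {u} {v} e = flatten ([ classify , classify-sym ∘ classify {v} {u} ]′ e)

  foot-walk : ∀ {n k K u v} → Within EE n u v → height u ≤ k → k + n ≤ K → Within (CycAdj p) (n * s ^ K) (foot u) (foot v)
  foot-walk stay _ _ = stay
  foot-walk {suc n} {k} {K} {u} (move {y = v} e w) h l =
    let w₁ , h' = foot-lipschitz {u} {v} e h in
    within-trans (within-≤ (^-monoʳ-≤ s (≤-trans (m≤m+n k (suc n)) l)) w₁) (foot-walk {u = v} w h' (subst (_≤ K) (+-suc k n) l))

  ℓ : ℕ
  ℓ = flapWalk r

  -- A representative on the new boundary for each index of the old one: x_i itself if it survives,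
  -- otherwise the first vertex y_i^- of its flap.
  perch : Fin p → EV
  perch i with T? (X i)
  ... | yes f = P f 0
  ... | no _ = inj₁ (b i)

  perch-flap : ∀ {i} (f : Flap i) → perch i ≡ P f 0
  perch-flap {i} f with T? (X i)
  ... | yes f' = cong (λ z → P z 0) (T-irrelevant f' f)
  ... | no n = ⊥-elim (n f)

  perch-free : ∀ {i} → ¬ Flap i → perch i ≡ inj₁ (b i)
  perch-free {i} n with T? (X i)
  ... | yes f = ⊥-elim (n f)
  ... | no _ = refl

  P-climb : ∀ {i} (f : Flap i) a n → a + n ≤ s + s → (∀ {k} → a ≤ k → k ≤ a + n → ¬ (T (I i) × k ≡ s)) → Within Bound n (P f a) (P f (a + n))
  P-climb f a n l free = within-walk (P f) a n λ {k} l₁ l₂ →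
    P-edge f (≤-trans l₁ l) , inB-P f (≤-trans (<⇒≤ l₁) l) (free l₂ (<⇒≤ l₁)) , inB-P f (≤-trans l₁ l) (free (≤-trans l₂ (n≤1+n k)) l₁)

  Q-descend : ∀ {i} (f : Flap i) (g : T (I i)) {j} → j < s → Within Bound (suc r + (1 + suc r)) (Q g j) (P f 0)
  Q-descend {i} f g {j} (s≤s l) = within-trans
    (within-≤ l (within-sym Bound-sym (within-walk (Q g) 0 j λ l₁ _ → Q-edge g (s≤s (≤-trans l₁ l)) , _ , _)))
    (move (Sum.swap (PQ-first f g) , _ , inB-P f (≤-trans (n≤1+n (suc r)) (m≤m+n s s)) (λ (_ , e) → 1+n≢n (sym e)))
      (within-sym Bound-sym (P-climb f 0 (suc r) (≤-trans (n≤1+n (suc r)) (m≤m+n s s)) λ _ l₂ (_ , e) → <⇒≢ (s≤s l₂) e)))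

  -- If Q_i is present, y_i is off the boundary, and from the far half the walk detours: back to
  -- v_i^+, through all of Q_i, out at v_i^- and down to y_i^-. The summands of `flapWalk` bound
  -- these pieces.
  P-descend : ∀ {i} (f : Flap i) {k} → k ≤ s + s → ¬ (T (I i) × k ≡ s) → Within Bound ℓ (P f k) (P f 0)
  P-descend {i} f {k} l n with T? (I i)
  ... | no g = within-≤ (≤-trans l (m≤m+n (s + s) _)) (within-sym Bound-sym (P-climb f 0 k l λ _ _ (g' , _) → g g'))
  ... | yes g with <-cmp k s
  ...   | tri< k<s _ _ = within-≤ (≤-trans l (m≤m+n (s + s) _))
            (within-sym Bound-sym (P-climb f 0 k l λ _ l₂ (_ , e) → <⇒≢ (≤-<-trans l₂ k<s) e))
  ...   | tri≈ _ e _ = ⊥-elim (n (g , e))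
  ...   | tri> _ _ s<k = within-trans (within-≤ (≤-trans (m∸n≤m k (suc s)) l) (within-sym Bound-sym
            (subst (λ z → Within Bound (k ∸ suc s) (P f (suc s)) (P f z)) k≡
              (P-climb f (suc s) (k ∸ suc s) (≤-trans (≤-reflexive k≡) l) λ l₁ _ (_ , e) → <⇒≢ l₁ (sym e)))))
          (move (PQ-last f g , inB-P f ss<s+s (λ (_ , e) → 1+n≢n e) , _) (Q-descend f g ≤-refl))
    where
    k≡ : suc s + (k ∸ suc s) ≡ k
    k≡ = m+[n∸m]≡n s<k

  to-perch : ∀ {v} → inB v → Within Bound ℓ v (perch (foot v))
  to-perch {inj₁ u} (j , refl , n) = subst (Within Bound ℓ (inj₁ (b j))) (sym (trans (cong perch (shadow-bd j)) (perch-free n))) stay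
  to-perch {inj₂ (inj₁ ((i , f) , q))} n = subst₂ (Within Bound ℓ) (sym (P-vertex f q)) (sym (perch-flap f)) (P-descend f (P≤ q) n)
  to-perch {inj₂ (inj₂ ((i , g) , q))} _ = subst₂ (Within Bound ℓ) (sym (Q-vertex g q)) (sym (perch-flap f))
      (within-≤ (≤-trans (n≤1+n _) (m≤n+m (suc (suc r + (1 + suc r))) (s + s))) (Q-descend f g (toℕ<n q)))
    where
    f : Flap i
    f = I⊆X i g

  private
    free-inB : ∀ {i} → ¬ Flap i → inB (inj₁ (b i))
    free-inB n = _ , refl , n

  -- By stability at most one of two consecutive indices carries a flap. The worst case traverses
  -- that flap from end to end and then takes one more edge.
  perch-next : ∀ {i j} → Next p i j → Within Bound (suc ℓ) (perch i) (perch j)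
  perch-next {i} {j} n = go (T? (X i)) (T? (X j))
    where
    go : Dec (Flap i) → Dec (Flap j) → Within Bound (suc ℓ) (perch i) (perch j)
    go (yes f) (yes f') = ⊥-elim (stable i j (inj₁ n) f f')
    go (yes f) (no m) = subst₂ (Within Bound (suc ℓ)) (sym (perch-flap f)) (sym (perch-free m))
      (within-≤ (≤-reflexive (+-comm ℓ 1)) (within-trans (within-sym Bound-sym (P-descend f ≤-refl last))
        (move (inj₂ (inj₂ (inj₂ (j , n , refl , trans (P-index ≤-refl) (sym lastP)))) , inB-P f ≤-refl last , free-inB m) stay)))
      where
      last : ¬ (T (I i) × s + s ≡ s)
      last (_ , e) = <⇒≢ s<2s (sym e)
    go (no m) (yes f) = subst₂ (Within Bound (suc ℓ)) (sym (perch-free m)) (sym (perch-flap f))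
      (move (inj₁ (inj₁ (i , n , refl , P-index z≤n)) , free-inB m , inB-P f z≤n (λ { (_ , ()) })) stay)
    go (no m) (no m') = subst₂ (Within Bound (suc ℓ)) (sym (perch-free m)) (sym (perch-free m'))
      (move (inj₁ (adjacent (inj₁ n)) , free-inB m , free-inB m') stay)

  perch-adj : ∀ {i j} → CycAdj p i j → Within Bound (suc ℓ) (perch i) (perch j)
  perch-adj (inj₁ n) = perch-next n
  perch-adj (inj₂ n) = within-sym Bound-sym (perch-next n)

  -- The terms of `spread` are a walk from `u` to its perch, at most n * s^n old boundary steps each
  -- replaced by a walk between consecutive perches, and a walk from the last perch to `v`.
  boundary-distance : ∀ {n u v} → inB u → inB v → Within EE n u v → Within Bound (spread r n) u v
  boundary-distance {n} a c w = within-≤ (≤-reflexive (sym (spread-def r n))) (within-trans (to-perch a) (within-trans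
    (within-bind perch perch-adj (foot-walk {k = 0} w (≤-reflexive (height-inB a)) ≤-refl))
    (within-sym Bound-sym (to-perch c))))

-- Reduced words in the edge-coloured cubic graph

third-colour : ∀ (i j c k : Fin 3) → i ≢ j → c ≢ i → c ≢ j → k ≢ i → k ≢ j → k ≡ c
third-colour = toWitness {a? = all? λ i → all? λ j → all? λ c → all? λ k →
  ¬? (i Fin.≟ j) →-dec ¬? (c Fin.≟ i) →-dec ¬? (c Fin.≟ j) →-dec ¬? (k Fin.≟ i) →-dec ¬? (k Fin.≟ j) →-dec (k Fin.≟ c)} _

other-colours : ∀ (c : Fin 3) → ∃ λ i → ∃ λ j → i ≢ j × c ≢ i × c ≢ j
other-colours Fin.zero = Fin.suc Fin.zero , Fin.suc (Fin.suc Fin.zero) , (λ ()) , (λ ()) , λ ()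
other-colours (Fin.suc Fin.zero) = Fin.zero , Fin.suc (Fin.suc Fin.zero) , (λ ()) , (λ ()) , λ ()
other-colours (Fin.suc (Fin.suc Fin.zero)) = Fin.zero , Fin.suc Fin.zero , (λ ()) , (λ ()) , λ ()

record Colouring {n : ℕ} (E : Rel (Fin n)) : Set where
  field
    mate          : Fin 3 → Fin n → Fin n
    mate-edge     : ∀ c x → E x (mate c x)
    mate-mate     : ∀ c x → mate c (mate c x) ≡ x
    mate-distinct : ∀ {c d} x → mate c x ≡ mate d x → c ≡ d
    colour        : ∀ {x y} → E x y → ∃ λ c → y ≡ mate c x

Word : Set
Word = List (Fin 3)

Fresh : Fin 3 → Word → Set
Fresh c [] = ⊤
Fresh c (d ∷ _) = c ≢ d

Reduced : Word → Set
Reduced [] = ⊤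
Reduced (c ∷ w) = Fresh c w × Reduced w

-- For reduced words: the reversal of the first followed by the second is again reduced. Letters act
-- as involutions, so reversal is inversion.
Apart : Word → Word → Set
Apart [] _ = ⊤
Apart (c ∷ _) w = Fresh c w

-- Left multiplication by a generator in the free product of three groups of order 2, on reduced
-- words.
cancel : Fin 3 → Word → Word
cancel c [] = c ∷ []
cancel c (d ∷ w) with c Fin.≟ d
... | yes _ = w
... | no _ = c ∷ d ∷ w

cancel-reduced : ∀ c w → Reduced w → Reduced (cancel c w)
cancel-reduced c [] _ = tt , tt
cancel-reduced c (d ∷ w) R with c Fin.≟ d
... | yes _ = proj₂ R
... | no n = n , R

cancel-length : ∀ c w → length (cancel c w) ≤ suc (length w)
cancel-length c [] = ≤-refl
cancel-length c (d ∷ w) with c Fin.≟ d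
... | yes _ = ≤-trans (n≤1+n _) (n≤1+n _)
... | no _ = ≤-refl

cancel-all : ∀ {Q : Fin 3 → Set} {c w} → Q c → All Q w → All Q (cancel c w)
cancel-all q [] = q ∷ []
cancel-all {c = c} q (_∷_ {d} q' a) with c Fin.≟ d
... | yes _ = a
... | no _ = q ∷ q' ∷ a

-- Without backtracking, the first return of a walk closes up a cycle.
walk-injective : ∀ {n} {E : Rel (Fin n)} {g} → (∀ {x} → ¬ E x x) → (∀ k (c : Fin k → Fin n) → IsCycleIn E k c → g ≤ k) →
  (z : ℕ → Fin n) {ℓ : ℕ} → ℓ < g → (∀ {k} → k < ℓ → E (z k) (z (suc k))) → (∀ {k} → suc k < ℓ → z k ≢ z (2 + k)) →
  ∀ D {d} i → d ≤ D → 0 < d → i + d ≤ ℓ → z i ≢ z (i + d)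
walk-injective {n} {E} {g} irr girth z {ℓ} ℓ<g step nb = go
  where
  go : ∀ D {d} i → d ≤ D → 0 < d → i + d ≤ ℓ → z i ≢ z (i + d)
  go (suc D) {1} i _ _ l e = irr (subst (E (z i)) (sym (trans e (cong z (+-comm i 1)))) (step (≤-trans (≤-reflexive (+-comm 1 i)) l)))
  go (suc D) {2} i _ _ l e = nb (≤-trans (≤-reflexive (+-comm 2 i)) l) (trans e (cong z (+-comm i 2)))
  go (suc D) {d@(suc (suc (suc _)))} i (s≤s l') _ l e =
    <⇒≱ (≤-<-trans (≤-trans (m≤n+m d i) l) ℓ<g) (girth d (λ a → z (i + toℕ a)) (s≤s (s≤s (s≤s z≤n)) , inj , adj))
    where
    -- A repetition strictly inside the closed stretch has a smaller gap than `d`, so the recursion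
    -- on `D` excludes it.
    lt : ∀ {a b} → a < b → b < d → z (i + a) ≢ z (i + b)
    lt {a} {b} a<b b<d e = go D (i + a) (≤-trans (m∸n≤m b a) (≤-trans (s≤s⁻¹ b<d) l')) (m<n⇒0<n∸m a<b)
        (≤-trans (≤-reflexive b≡) (≤-trans (+-monoʳ-≤ i (<⇒≤ b<d)) l)) (trans e (cong z (sym b≡)))
      where
      b≡ : i + a + (b ∸ a) ≡ i + b
      b≡ = trans (+-assoc i a (b ∸ a)) (cong (i +_) (m+[n∸m]≡n (<⇒≤ a<b)))
    inj : Injective _≡_ _≡_ (λ (a : Fin d) → z (i + toℕ a))
    inj {a} {b} e with <-cmp (toℕ a) (toℕ b)
    ... | tri< a<b _ _ = ⊥-elim (lt a<b (toℕ<n b) e)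
    ... | tri≈ _ q _ = toℕ-injective q
    ... | tri> _ _ b<a = ⊥-elim (lt b<a (toℕ<n a) (sym e))
    stp : ∀ (a : Fin d) → E (z (i + toℕ a)) (z (i + suc (toℕ a)))
    stp a = subst (λ k → E (z (i + toℕ a)) (z k)) (sym (+-suc i (toℕ a))) (step (≤-trans (≤-reflexive (sym (+-suc i (toℕ a)))) (≤-trans (+-monoʳ-≤ i (toℕ<n a)) l)))
    adj : ∀ a b → Next d a b → E (z (i + toℕ a)) (z (i + toℕ b))
    adj a b (inj₁ q) = subst (λ k → E (z (i + toℕ a)) (z (i + k))) q (stp a)
    adj a b (inj₂ (q , q')) = subst (E (z (i + toℕ a))) (trans (cong (λ k → z (i + k)) q) (trans (sym e) (cong z (trans (sym (+-identityʳ i)) (cong (i +_) (sym q')))))) (stp a)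
  go zero {suc d} i ()
  go _ {zero} i _ ()

module Words {n : ℕ} {E : Rel (Fin n)} (irr : ∀ {x} → ¬ E x x) (K : Colouring E) (g : ℕ)
             (girth : ∀ k (c : Fin k → Fin n) → IsCycleIn E k c → g ≤ k) where
  open Colouring K

  act : Word → Fin n → Fin n
  act [] x = x
  act (c ∷ w) x = act w (mate c x)

  trail : Word → Fin n → ℕ → Fin n
  trail [] x _ = x
  trail (c ∷ w) x zero = x
  trail (c ∷ w) x (suc k) = trail w (mate c x) k

  trail-0 : ∀ w x → trail w x 0 ≡ x
  trail-0 [] x = refl
  trail-0 (_ ∷ _) x = refl

  trail-end : ∀ w x → trail w x (length w) ≡ act w x
  trail-end [] x = refl
  trail-end (c ∷ w) x = trail-end w (mate c x)

  trail-step : ∀ w x {k} → k < length w → E (trail w x k) (trail w x (suc k))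
  trail-step (c ∷ w) x {zero} _ = subst (E x) (sym (trail-0 w (mate c x))) (mate-edge c x)
  trail-step (c ∷ w) x {suc k} (s≤s l) = trail-step w (mate c x) l

  trail-turn : ∀ w x {k} → Reduced w → suc k < length w → trail w x k ≢ trail w x (2 + k)
  trail-turn (c ∷ d ∷ w) x {zero} (f , _) _ e = f (sym (mate-distinct (mate c x) (trans (sym (trail-0 w (mate d (mate c x)))) (trans (sym e) (sym (mate-mate c x))))))
  trail-turn (c ∷ []) x {zero} _ (s≤s ())
  trail-turn (c ∷ w) x {suc k} (_ , R) (s≤s l) = trail-turn w (mate c x) R l

  closed-trivial : ∀ w {x} → Reduced w → act w x ≡ x → length w < g → w ≡ []
  closed-trivial [] _ _ _ = refl
  closed-trivial w@(_ ∷ _) {x} R e l = ⊥-elim (walk-injective {E = E} irr girth (trail w x) l (trail-step w x) (trail-turn w x R)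
    (length w) 0 ≤-refl (s≤s z≤n) ≤-refl (trans (trail-0 w x) (trans (sym e) (sym (trail-end w x)))))

  -- Moving the first letter from one word to the front of the other preserves the common end and
  -- the total length. Repeating this assembles the inverse of `w` followed by `w'`, a short reduced
  -- closed word, which the girth forbids unless `w` was empty from the start.
  meet-trivially : ∀ w w' {x} → Reduced w → Reduced w' → Apart w w' → act w x ≡ act w' x → length w + length w' < g → w ≡ []
  meet-trivially [] _ _ _ _ _ _ = refl
  meet-trivially (c ∷ w) w' {x} (f , R) R' A e l with meet-trivially w (c ∷ w') {mate c x} R (A , R') (apart-sym w f)
      (trans e (cong (act w') (sym (mate-mate c x)))) (≤-trans (≤-reflexive (cong suc (+-suc (length w) (length w')))) l)
    where
    apart-sym : ∀ w → Fresh c w → Apart w (c ∷ w')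
    apart-sym [] _ = tt
    apart-sym (d ∷ w) f = f ∘ sym
  ... | refl with closed-trivial (c ∷ w') {mate c x} (A , R') (trans (cong (act w') (mate-mate c x)) (sym e)) l
  ...   | ()

  word-unique : ∀ w w' {x} → Reduced w → Reduced w' → act w x ≡ act w' x → length w + length w' < g → w ≡ w'
  word-unique [] w' _ R' e l = sym (closed-trivial w' R' (sym e) l)
  word-unique (c ∷ w) [] R _ e l = closed-trivial (c ∷ w) R e (≤-trans (s≤s (≤-reflexive (sym (+-identityʳ _)))) l)
  word-unique (c ∷ w) (d ∷ w') R R' e l with c Fin.≟ d
  ... | yes refl = cong (c ∷_) (word-unique w w' (proj₂ R) (proj₂ R') e
          (≤-trans (s≤s (+-mono-≤ (n≤1+n (length w)) (n≤1+n (length w')))) l))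
  ... | no c≢d with meet-trivially (c ∷ w) (d ∷ w') R R' c≢d e l
  ...   | ()

  cancel-act : ∀ c w x → act (cancel c w) x ≡ act w (mate c x)
  cancel-act c [] x = refl
  cancel-act c (d ∷ w) x with c Fin.≟ d
  ... | yes refl = cong (act w) (sym (mate-mate c x))
  ... | no _ = refl

  record Path (i : Fin 3) (d : ℕ) (x y : Fin n) : Set where
    field
      word    : Word
      reduced : Reduced word
      avoids  : All (_≢ i) word
      short   : length word ≤ d
      ends    : act word x ≡ y

  toPath : ∀ {i d x y} → Within (λ x y → ∃ λ c → c ≢ i × y ≡ mate c x) d x y → Path i d x y
  toPath stay = record { word = [] ; reduced = tt ; avoids = [] ; short = z≤n ; ends = refl }
  toPath {x = x} (move (c , c≢i , refl) w) = record
    { word = cancel c word ; reduced = cancel-reduced c word reduced ; avoids = cancel-all c≢i avoids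
    ; short = ≤-trans (cancel-length c word) (s≤s short) ; ends = trans (cancel-act c word x) ends }
    where open Path (toPath w)

  module _ {i j c : Fin 3} (i≢j : i ≢ j) (c≢i : c ≢ i) (c≢j : c ≢ j) where

    -- Only the colour `c` is left, and a reduced word cannot use the same letter twice in a row.
    common : ∀ {w} → Reduced w → All (_≢ i) w → All (_≢ j) w → w ≡ [] ⊎ w ≡ c ∷ []
    common {[]} _ _ _ = inj₁ refl
    common {k ∷ []} _ (a ∷ _) (b ∷ _) = inj₂ (cong (_∷ []) (third-colour i j c k i≢j c≢i c≢j a b))
    common {k ∷ k' ∷ w} (f , _) (a ∷ a' ∷ _) (b ∷ b' ∷ _) =
      ⊥-elim (f (trans (third-colour i j c k i≢j c≢i c≢j a b) (sym (third-colour i j c k' i≢j c≢i c≢j a' b'))))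

    at-ends : ∀ {w x y} → w ≡ [] ⊎ w ≡ c ∷ [] → act w y ≡ x → y ≡ x ⊎ y ≡ mate c x
    at-ends (inj₁ refl) e = inj₁ e
    at-ends {y = y} (inj₂ refl) e = inj₂ (trans (sym (mate-mate c y)) (cong (mate c) e))

    two-paths : ∀ {d d' x y} → Path i d y x → Path j d' y x → d + d' < g → y ≡ x ⊎ y ≡ mate c x
    two-paths {x = x} {y} p q l = at-ends (common P.reduced P.avoids (subst (All (_≢ j)) (sym w≡) Q.avoids)) P.ends
      where
      module P = Path p
      module Q = Path q
      w≡ : P.word ≡ Q.word
      w≡ = word-unique P.word Q.word P.reduced Q.reduced (trans P.ends (sym Q.ends)) (≤-<-trans (+-mono-≤ P.short Q.short) l)

    -- The word from `y` is the letter of the edge `yz` times the word from `z`. Unless the latter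
    -- is empty, which puts `z` at `x`, that letter cancels or not; accordingly one of the two words
    -- is the tail of the other and avoids both `i` and `j`.
    two-paths-edge : ∀ {d d' x y z} → Path i d y x → Path j d' z x → E y z → suc (d + d') < g →
                     (y ≡ x ⊎ y ≡ mate c x) ⊎ (z ≡ x ⊎ z ≡ mate c x)
    two-paths-edge {d} {d'} {x} {y} {z} p q yz l with colour yz
    ... | k , refl = go Q.word P.word refl refl
      where
      module P = Path p
      module Q = Path q
      w≡ : P.word ≡ cancel k Q.word
      w≡ = word-unique P.word (cancel k Q.word) {y} P.reduced (cancel-reduced k Q.word Q.reduced) (trans P.ends (trans (sym Q.ends) (sym (cancel-act k Q.word y))))
        (≤-<-trans (+-mono-≤ P.short (≤-trans (cancel-length k Q.word) (s≤s Q.short))) (≤-trans (≤-reflexive (cong suc (+-suc d d'))) l))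
      go : ∀ w v → w ≡ Q.word → v ≡ P.word → (y ≡ x ⊎ y ≡ mate c x) ⊎ (z ≡ x ⊎ z ≡ mate c x)
      go w v refl refl with Q.word | P.word | Q.reduced | Q.avoids | P.reduced | P.avoids | P.ends | Q.ends | w≡
      ... | [] | _ | _ | _ | _ | _ | _ | e' | _ = inj₂ (inj₁ e')
      ... | m ∷ w | v | R | b ∷ bs | R' | as | e | e' | q≡ with k Fin.≟ m
      ...   | yes _ = inj₁ (at-ends (common R' as (subst (All (_≢ j)) (sym q≡) bs)) e)
      ...   | no _ with v | as | q≡
      ...     | _ | _ ∷ as' | refl = inj₂ (at-ends (common R as' (b ∷ bs)) e')

  -- The construction indexes territories by vertex sets of components, so the one through `x` has
  -- to be produced as a `Subset`. It is saturated vertex by vertex; the invariant that size plus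
  -- fuel is at least `n` shows that the fuel suffices.
  component : ∀ i x → ∃ λ S → x ∈ S × IsComponent (λ x y → ∃ λ c → c ≢ i × y ≡ mate c x) S
  component i x = let S , x∈S , reach , closed = grow n ⁅ x ⁆ (λ y∈ → subst (Star R x) (sym (x∈⁅y⁆⇒x≡y _ y∈)) ε) (x∈⁅x⁆ x) (m≤n+m n _)
                  in S , x∈S , (x , x∈S) , (λ y z → closed) , λ y z y∈ z∈ → reverse R-sym (reach y∈) ◅◅ reach z∈
    where
    R : Rel (Fin n)
    R x y = ∃ λ c → c ≢ i × y ≡ mate c x
    R-sym : Sym R
    R-sym (c , c≢i , refl) = c , c≢i , sym (mate-mate c _)
    grow : ∀ fuel S → (∀ {y} → y ∈ S → Star R x y) → x ∈ S → n ≤ ∣ S ∣ + fuel →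
           ∃ λ S' → x ∈ S' × (∀ {y} → y ∈ S' → Star R x y) × (∀ {y z} → y ∈ S' → R y z → z ∈ S')
    grow fuel S reach x∈S l with any? (λ y → any? (λ c → (y ∈? S) ×-dec ¬? (c Fin.≟ i) ×-dec ¬? (mate c y ∈? S)))
    ... | no none = S , x∈S , reach , λ { {y} y∈ (c , c≢i , refl) → stays y∈ c≢i (mate c y ∈? S) }
      where
      stays : ∀ {y c} → y ∈ S → c ≢ i → Dec (mate c y ∈ S) → mate c y ∈ S
      stays _ _ (yes q) = q
      stays {y} {c} a b (no q) = ⊥-elim (none (y , c , a , b , q))
    ... | yes (y , c , y∈ , c≢i , z∉) = continue fuel l
      where
      S₁ : Subset n
      S₁ = S ∪ ⁅ mate c y ⁆
      bigger : ∣ S ∣ < ∣ S₁ ∣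
      bigger = p⊂q⇒∣p∣<∣q∣ (p⊆p∪q _ , mate c y , x∈p∪q⁺ (inj₂ (x∈⁅x⁆ _)) , z∉)
      reach₁ : ∀ {z} → z ∈ S₁ → Star R x z
      reach₁ {z} z∈ with x∈p∪q⁻ S _ z∈
      ... | inj₁ q = reach q
      ... | inj₂ q = reach y∈ ◅◅ (c , c≢i , x∈⁅y⁆⇒x≡y _ q) ◅ ε
      continue : ∀ fuel → n ≤ ∣ S ∣ + fuel → _
      continue zero l = ⊥-elim (<⇒≱ (<-≤-trans bigger (∣p∣≤n S₁)) (≤-trans l (≤-reflexive (+-identityʳ _))))
      continue (suc fuel) l = grow fuel S₁ reach₁ (p⊆p∪q _ x∈S) (≤-trans l (≤-trans (≤-reflexive (+-suc _ fuel)) (+-monoˡ-≤ fuel bigger)))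

within-map : {A : Set} {R S : Rel A} → (∀ {x y} → R x y → S x y) → ∀ {n x y} → Within R n x y → Within S n x y
within-map f stay = stay
within-map f (move r w) = move (f r) (within-map f w)

cycle-within : {A : Set} {R : Rel A} → Sym R → ∀ {N f} → IsInducedCycle R (suc N) f → ∀ i j → Within R (suc N) (f i) (f j)
cycle-within {A} {R} sy {N} {f} F i j = [ forward i j , within-sym sy ∘ forward j i ]′ (≤-total (toℕ i) (toℕ j))
  where
  module W = InducedCycle (window {R = R} {f = f} sy F 0)
  forward : ∀ i j → toℕ i ≤ toℕ j → Within R (suc N) (f i) (f j)
  forward i j l = within-≤ (≤-trans (m∸n≤m (toℕ j) (toℕ i)) (<⇒≤ (toℕ<n j)))
    (subst₂ (Within R (toℕ j ∸ toℕ i)) (cong f (mod-toℕ i)) (cong f (trans (cong (_mod suc N) e) (mod-toℕ j)))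
      (within-walk (λ k → f (k mod suc N)) (toℕ i) (toℕ j ∸ toℕ i) λ l' _ → W.step (≤-<-trans (≤-trans l' (≤-reflexive e)) (toℕ<n j))))
    where
    e : toℕ i + (toℕ j ∸ toℕ i) ≡ toℕ j
    e = m+[n∸m]≡n l

third-neighbour : {A : Set} {a b c p q : A} → a ≢ b → a ≢ c → b ≢ c →
  (p ≡ a ⊎ p ≡ b ⊎ p ≡ c) → (q ≡ a ⊎ q ≡ b ⊎ q ≡ c) → p ≢ q →
  ∃ λ z → (z ≡ a ⊎ z ≡ b ⊎ z ≡ c) × z ≢ p × z ≢ q × (∀ {y} → y ≡ a ⊎ y ≡ b ⊎ y ≡ c → y ≡ p ⊎ y ≡ q ⊎ y ≡ z)
third-neighbour ab ac bc (inj₁ refl) (inj₁ refl) pq = ⊥-elim (pq refl)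
third-neighbour ab ac bc (inj₁ refl) (inj₂ (inj₁ refl)) pq = _ , inj₂ (inj₂ refl) , ac ∘ sym , bc ∘ sym , λ x → x
third-neighbour ab ac bc (inj₁ refl) (inj₂ (inj₂ refl)) pq = _ , inj₂ (inj₁ refl) , ab ∘ sym , bc , Sum.map₂ Sum.swap
third-neighbour ab ac bc (inj₂ (inj₁ refl)) (inj₁ refl) pq = _ , inj₂ (inj₂ refl) , bc ∘ sym , ac ∘ sym ,
  λ { (inj₁ e) → inj₂ (inj₁ e) ; (inj₂ (inj₁ e)) → inj₁ e ; (inj₂ (inj₂ e)) → inj₂ (inj₂ e) }
third-neighbour ab ac bc (inj₂ (inj₁ refl)) (inj₂ (inj₁ refl)) pq = ⊥-elim (pq refl)
third-neighbour ab ac bc (inj₂ (inj₁ refl)) (inj₂ (inj₂ refl)) pq = _ , inj₁ refl , ab , ac ,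
  λ { (inj₁ e) → inj₂ (inj₂ e) ; (inj₂ (inj₁ e)) → inj₁ e ; (inj₂ (inj₂ e)) → inj₂ (inj₁ e) }
third-neighbour ab ac bc (inj₂ (inj₂ refl)) (inj₁ refl) pq = _ , inj₂ (inj₁ refl) , bc , ab ∘ sym ,
  λ { (inj₁ e) → inj₂ (inj₁ e) ; (inj₂ (inj₁ e)) → inj₂ (inj₂ e) ; (inj₂ (inj₂ e)) → inj₁ e }
third-neighbour ab ac bc (inj₂ (inj₂ refl)) (inj₂ (inj₁ refl)) pq = _ , inj₁ refl , ac , ab ,
  λ { (inj₁ e) → inj₂ (inj₂ e) ; (inj₂ (inj₁ e)) → inj₂ (inj₁ e) ; (inj₂ (inj₂ e)) → inj₁ e }
third-neighbour ab ac bc (inj₂ (inj₂ refl)) (inj₂ (inj₂ refl)) pq = ⊥-elim (pq refl)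

-- The numerical bound, and walks around a cycle, against the girth

spread>0 : ∀ r n → 1 ≤ spread r n
spread>0 r n = ≤-trans (m≤m+n 1 _) (≤-reflexive (sym (spread-def r n)))

-- Here `flapWalk` plus one is at most 4t and (t - 3)^(2t) at most t^(2t), so each `spread` is at
-- most 16B with B = t^(2t+2). Two of them plus 2 make at most 34B, which is below 125B ≤ t^3 B =
-- t^(2t+5), and 2t + 5 ≤ 5t.
spread<girth : ∀ r → suc (spread r (2 * (5 + r)) + spread r (2 * (5 + r))) < (5 + r) ^ (5 * (5 + r))
spread<girth r = begin
  2 + (D + D)              ≤⟨ +-mono-≤ {2} {2 * B} (≤-trans (≤-reflexive (sym (*-identityʳ 2))) (*-monoʳ-≤ 2 1≤B)) (+-mono-≤ D≤ D≤) ⟩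
  2 * B + (16 * B + 16 * B) ≡⟨ solve 1 (λ b → con 2 :* b :+ (con 16 :* b :+ con 16 :* b) := con 34 :* b) refl B ⟩
  34 * B                   ≤⟨ *-monoˡ-≤ B (m≤m+n 34 91) ⟩
  125 * B                  ≡⟨ solve 1 (λ b → con 125 :* b := con 5 :* (con 5 :* (con 5 :* b))) refl B ⟩
  5 * (5 * (5 * B))        ≤⟨ *-mono-≤ 5≤t (*-mono-≤ 5≤t (*-monoˡ-≤ B 5≤t)) ⟩
  t * (t * (t * B))        ≡⟨⟩
  t ^ (5 + 2 * t)          ≤⟨ ^-monoʳ-≤ t exponent ⟩
  t ^ (5 * t)              ∎
  where
  open ≤-Reasoning
  open +-*-Solver
  s t ℓ D A B : ℕ
  s = 2 + r
  t = 5 + r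
  ℓ = flapWalk r
  D = spread r (2 * t)
  A = t ^ (2 * t)
  B = t * (t * A)
  5≤t : 5 ≤ t
  5≤t = m≤m+n 5 r
  1≤A : 1 ≤ A
  1≤A = m^n>0 t (2 * t)
  t≤B : t ≤ B
  t≤B = ≤-trans (≤-reflexive (sym (*-identityʳ t))) (*-monoʳ-≤ t (*-mono-≤ {1} {t} (s≤s z≤n) 1≤A))
  1≤B : 1 ≤ B
  1≤B = ≤-trans (s≤s z≤n) t≤B
  sucℓ≤ : suc ℓ ≤ 4 * t
  sucℓ≤ = ≤-trans (m≤m+n (suc ℓ) 11) (≤-reflexive (solve 1 (λ r → con 1 :+ ((con 2 :+ r :+ (con 2 :+ r)) :+ (con 1 :+ (con 1 :+ r :+ (con 1 :+ (con 1 :+ r))))) :+ con 11 := con 4 :* (con 5 :+ r)) refl r))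
  ℓ≤ : ℓ ≤ 4 * B
  ℓ≤ = ≤-trans (n≤1+n ℓ) (≤-trans sucℓ≤ (*-monoʳ-≤ 4 t≤B))
  D≤ : D ≤ 16 * B
  D≤ = begin
    D                                ≡⟨ spread-def r (2 * t) ⟩
    ℓ + (2 * t * s ^ (2 * t) * suc ℓ + ℓ) ≤⟨ +-mono-≤ ℓ≤ (+-mono-≤ (*-mono-≤ (*-monoʳ-≤ (2 * t) (^-monoˡ-≤ (2 * t) (m≤n+m s 3))) sucℓ≤) ℓ≤) ⟩
    4 * B + (2 * t * A * (4 * t) + 4 * B) ≡⟨ solve 2 (λ t a → con 4 :* (t :* (t :* a)) :+ (con 2 :* t :* a :* (con 4 :* t) :+ con 4 :* (t :* (t :* a))) := con 16 :* (t :* (t :* a))) refl t A ⟩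
    16 * B                           ∎
  exponent : 5 + 2 * t ≤ 5 * t
  exponent = ≤-trans (+-monoˡ-≤ (2 * t) (≤-trans 5≤t (m≤m+n t (2 * t)))) (≤-reflexive (solve 1 (λ t → t :+ con 2 :* t :+ con 2 :* t := con 5 :* t) refl t))

-- The graph G_t

module Proof (r : ℕ) (C : Construction (5 + r)) (g : ℕ)
             (girthΓ : ∀ k (c : Fin k → Fin (Construction.n C)) → IsCycleIn (Construction.EΓ C) k c → g ≤ k)
             (D : ℕ) (spread≤D : spread r (2 * (5 + r)) ≤ D) (0<D : 1 ≤ D) (2D<g : suc (D + D) < g) where
  open Construction C

  private
    s t : ℕ
    s = 2 + r
    t = 5 + r

    EΩ-sym : ∀ {x y} → EΩ x y → EΩ y x
    EΩ-sym (i , j , n , e) = i , j , n , Sum.map (λ (a , b) → b , a) (λ (a , b) → b , a) (Sum.swap e)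

    M-sym : ∀ c {x y} → M c x y → M c y x
    M-sym Fin.zero = proj₁ M₁-pm _ _
    M-sym (Fin.suc Fin.zero) = proj₁ M₂-pm _ _
    M-sym (Fin.suc (Fin.suc Fin.zero)) (e , n) = proj₁ simpleΓ e , n ∘ EΩ-sym

    mate₁ mate₂ : Fin n → Fin n
    mate₁ x = proj₁ (proj₂ (proj₂ M₁-pm) x)
    mate₂ x = proj₁ (proj₂ (proj₂ M₂-pm) x)
    M-mate₁ : ∀ x → M₁ x (mate₁ x)
    M-mate₁ x = proj₁ (proj₂ (proj₂ (proj₂ M₁-pm) x))
    M-mate₂ : ∀ x → M₂ x (mate₂ x)
    M-mate₂ x = proj₁ (proj₂ (proj₂ (proj₂ M₂-pm) x))

    -- M₃ is given only as a complement. Its partner of `x` is the neighbour left over when the M₁-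
    -- and M₂-partners, distinct by `M-disj`, are taken out of the three.
    mate₃-spec : ∀ x → ∃ λ z → EΓ x z × z ≢ mate₁ x × z ≢ mate₂ x × (∀ {y} → EΓ x y → y ≡ mate₁ x ⊎ y ≡ mate₂ x ⊎ y ≡ z)
    mate₃-spec x =
      let a , b , c , ab , ac , bc , nb = cubic x
          z , z∈ , z≢₁ , z≢₂ , all = third-neighbour ab ac bc
            (Equivalence.to (nb _) (proj₁ (proj₂ M₁-pm) _ _ (M-mate₁ x)))
            (Equivalence.to (nb _) (proj₁ (proj₂ M₂-pm) _ _ (M-mate₂ x)))
            (λ e → M-disj x (mate₁ x) (M-mate₁ x) (subst (M₂ x) (sym e) (M-mate₂ x)))
      in z , Equivalence.from (nb z) z∈ , z≢₁ , z≢₂ , λ e → all (Equivalence.to (nb _) e)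

    mateΓ : Fin 3 → Fin n → Fin n
    mateΓ Fin.zero = mate₁
    mateΓ (Fin.suc Fin.zero) = mate₂
    mateΓ (Fin.suc (Fin.suc Fin.zero)) x = proj₁ (mate₃-spec x)

    M-unique : ∀ c {x y} → M c x y → y ≡ mateΓ c x
    M-unique Fin.zero = proj₂ (proj₂ (proj₂ (proj₂ M₁-pm) _)) _
    M-unique (Fin.suc Fin.zero) = proj₂ (proj₂ (proj₂ (proj₂ M₂-pm) _)) _
    M-unique (Fin.suc (Fin.suc Fin.zero)) {x} {y} (e , n) with proj₂ (proj₂ (proj₂ (proj₂ (mate₃-spec x)))) e
    ... | inj₁ refl = ⊥-elim (n (Equivalence.from (M-cover _ _) (inj₁ (M-mate₁ x))))
    ... | inj₂ (inj₁ refl) = ⊥-elim (n (Equivalence.from (M-cover _ _) (inj₂ (M-mate₂ x))))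
    ... | inj₂ (inj₂ e') = e'

    M-mate : ∀ c x → M c x (mateΓ c x)
    M-mate Fin.zero = M-mate₁
    M-mate (Fin.suc Fin.zero) = M-mate₂
    M-mate (Fin.suc (Fin.suc Fin.zero)) x = let z , e , z≢₁ , z≢₂ , _ = mate₃-spec x in
      e , [ z≢₁ ∘ M-unique Fin.zero , z≢₂ ∘ M-unique (Fin.suc Fin.zero) ]′ ∘ Equivalence.to (M-cover x z)

    M⊆EΓ : ∀ c {x y} → M c x y → EΓ x y
    M⊆EΓ Fin.zero = proj₁ (proj₂ M₁-pm) _ _
    M⊆EΓ (Fin.suc Fin.zero) = proj₁ (proj₂ M₂-pm) _ _
    M⊆EΓ (Fin.suc (Fin.suc Fin.zero)) = proj₁

    M-disjoint : ∀ c d {x y} → M c x y → M d x y → c ≡ d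
    M-disjoint Fin.zero Fin.zero _ _ = refl
    M-disjoint Fin.zero (Fin.suc Fin.zero) a b = ⊥-elim (M-disj _ _ a b)
    M-disjoint Fin.zero (Fin.suc (Fin.suc Fin.zero)) a (_ , n) = ⊥-elim (n (Equivalence.from (M-cover _ _) (inj₁ a)))
    M-disjoint (Fin.suc Fin.zero) Fin.zero a b = ⊥-elim (M-disj _ _ b a)
    M-disjoint (Fin.suc Fin.zero) (Fin.suc Fin.zero) _ _ = refl
    M-disjoint (Fin.suc Fin.zero) (Fin.suc (Fin.suc Fin.zero)) a (_ , n) = ⊥-elim (n (Equivalence.from (M-cover _ _) (inj₂ a)))
    M-disjoint (Fin.suc (Fin.suc Fin.zero)) Fin.zero (_ , n) b = ⊥-elim (n (Equivalence.from (M-cover _ _) (inj₁ b)))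
    M-disjoint (Fin.suc (Fin.suc Fin.zero)) (Fin.suc Fin.zero) (_ , n) b = ⊥-elim (n (Equivalence.from (M-cover _ _) (inj₂ b)))
    M-disjoint (Fin.suc (Fin.suc Fin.zero)) (Fin.suc (Fin.suc Fin.zero)) _ _ = refl

  colouring : Colouring EΓ
  colouring = record
    { mate = mateΓ
    ; mate-edge = λ c x → M⊆EΓ c (M-mate c x)
    ; mate-mate = λ c x → sym (M-unique c (M-sym c (M-mate c x)))
    ; mate-distinct = λ {c} {d} x e → M-disjoint c d (M-mate c x) (subst (M d x) (sym e) (M-mate d x))
    ; colour = λ {x} {y} e → [ Fin.zero ,_ , [ Fin.suc Fin.zero ,_ , Fin.suc (Fin.suc Fin.zero) ,_ ]′ ]′ (proj₂ (proj₂ (proj₂ (proj₂ (mate₃-spec x)))) e) }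

  open Colouring colouring
  open Words (λ {x} → proj₂ simpleΓ {x}) colouring g girthΓ

  H→mate : ∀ {i x y} → H i x y → ∃ λ c → c ≢ i × y ≡ mate c x
  H→mate {i} {x} (e , n) = let c , q = colour e in c , (λ { refl → n (subst (M c x) (sym q) (M-mate c x)) }) , q

  mate→H : ∀ {i x y} → (∃ λ c → c ≢ i × y ≡ mate c x) → H i x y
  mate→H {i} {x} (c , c≢i , refl) = mate-edge c x , λ m → c≢i (M-disjoint c i (M-mate c x) m)

  componentH : ∀ i x → ∃ λ S → x ∈ S × IsComponent (H i) S
  componentH i x = let S , x∈ , ne , closed , conn = component i x in
    S , x∈ , ne , (λ y z y∈ h → closed y z y∈ (H→mate h)) , λ y z y∈ z∈ → gmap (λ a → a) mate→H (conn y z y∈ z∈)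

  Edge∋ : ∀ i S → U → U → Set
  Edge∋ i S û v̂ = ∃ λ a → ∃ λ a' → ι i S a ≡ û × ι i S a' ≡ v̂ × E (TK i S) a a'

  EdgeΓ : U → U → Set
  EdgeΓ û v̂ = ∃ λ x → ∃ λ y → ιΓ x ≡ û × ιΓ y ≡ v̂ × EΓ x y

  _≟K_ : (κ κ' : Fin 3 × Subset n) → Dec (κ ≡ κ')
  (i , S) ≟K (i' , S') with i Fin.≟ i' | Vec.≡-dec Bool._≟_ S S'
  ... | yes refl | yes refl = yes refl
  ... | no n | _ = no λ { refl → n refl }
  ... | _ | no n = no λ { refl → n refl }

  module Part (i : Fin 3) (S : Subset n) (K : IsComponent (H i) S) where
    private
      m = proj₁ (TK-canon i S K)
      d = proj₁ (proj₂ (TK-canon i S K))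
    module X = ExpandedTerritory r (Tm t m) (territory r m) d
    open Expansion t (Tm t m) d public using (EV; EE; inB)
    private
      φ = proj₁ (proj₂ (proj₂ (TK-canon i S K)))
      φE = proj₁ (proj₂ (proj₂ (proj₂ (TK-canon i S K))))
      φB = proj₂ (proj₂ (proj₂ (proj₂ (TK-canon i S K))))
    open Inverse φ using (strictlyInverseˡ; strictlyInverseʳ) renaming (to to pos; from to vertex) public

    place : EV → U
    place v = ι i S (vertex v)

    place-pos : ∀ a → place (pos a) ≡ ι i S a
    place-pos a = cong (ι i S) (strictlyInverseʳ a)

    place-inj : ∀ {u v} → place u ≡ place v → u ≡ v
    place-inj {u} {v} e = trans (sym (strictlyInverseˡ u)) (trans (cong pos (ι-inj i S e)) (strictlyInverseˡ v))

    E→EE : ∀ {u v} → E (TK i S) (vertex u) (vertex v) → EE u v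
    E→EE {u} {v} e = subst₂ EE (strictlyInverseˡ u) (strictlyInverseˡ v) (Equivalence.to (φE _ _) e)

    EE→E : ∀ {u v} → EE u v → E (TK i S) (vertex u) (vertex v)
    EE→E {u} {v} e = Equivalence.from (φE _ _) (subst₂ EE (sym (strictlyInverseˡ u)) (sym (strictlyInverseˡ v)) e)

    EE→EG : ∀ {u v} → EE u v → EG (place u) (place v)
    EE→EG e = inj₂ (i , S , K , _ , _ , refl , refl , EE→E e)

    in-part : ∀ v → inTK i S (place v)
    in-part v = vertex v , refl

    pos-of : ∀ {û} → inTK i S û → ∃ λ v → place v ≡ û
    pos-of (a , refl) = pos a , place-pos a

    inB→S : ∀ {v} → inB v → inK S (place v)
    inB→S {v} b = Equivalence.from (φB (vertex v)) (subst inB (sym (strictlyInverseˡ v)) b)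

    S→inB : ∀ {v} → inK S (place v) → inB v
    S→inB {v} k = subst inB (strictlyInverseˡ v) (Equivalence.to (φB (vertex v)) k)

    Γ→S : ∀ {û} → inTK i S û → inΓ û → inK S û
    Γ→S a b = Equivalence.to (TK∩Γ i S K _) (a , b)

    S→TK : ∀ {û} → inK S û → inTK i S û
    S→TK k = proj₁ (Equivalence.from (TK∩Γ i S K _) k)

    Γ∈S : ∀ {x v} → ιΓ x ≡ place v → x ∈ S
    Γ∈S {x} {v} e with Γ→S (in-part v) (x , e)
    ... | y , y∈ , e' = subst (_∈ S) (ιΓ-inj (trans e' (sym e))) y∈

    EE→H : ∀ {x y u v} → ιΓ x ≡ place u → ιΓ y ≡ place v → EE u v → H i x y
    EE→H e e' h = Equivalence.to (TK-K i S K _ _ _ _ (Γ∈S e) (Γ∈S e') (sym e) (sym e')) (EE→E h)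

    H→EE : ∀ {x y u v} → ιΓ x ≡ place u → ιΓ y ≡ place v → H i x y → EE u v
    H→EE e e' h = E→EE (Equivalence.from (TK-K i S K _ _ _ _ (Γ∈S e) (Γ∈S e') (sym e) (sym e')) h)

    -- Boundary vertices lie in Γ, and `TK-K` identifies the edges of T_K between them with edges of
    -- Γ of colour other than `i`.
    bound-walk : ∀ {k x y u v} → ιΓ x ≡ place u → ιΓ y ≡ place v → Within X.Bound k u v → Within (λ x y → ∃ λ c → c ≢ i × y ≡ mate c x) k x y
    bound-walk {x = x} e e' stay = subst (Within _ _ x) (ιΓ-inj (trans e (sym e'))) stay
    bound-walk e e' (move (h , _ , b) w) = let z , _ , q = inB→S b in move (H→mate (EE→H e q h)) (bound-walk q e' w)

    onΓ-inB : ∀ {x u} → ιΓ x ≡ place u → inB u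
    onΓ-inB e = S→inB (Γ→S (in-part _) (_ , e))

    -- This converts nearness in the territory, where shortcuts exist, into a short reduced word of
    -- Γ without the colour `i`; from here on only words and the girth matter.
    close : ∀ {x y u v} → ιΓ x ≡ place u → ιΓ y ≡ place v → Within EE (2 * t) u v → Path i D x y
    close e e' w = toPath (within-≤ spread≤D (bound-walk e e' (X.boundary-distance (onΓ-inB e) (onΓ-inB e') w)))

  gamma-edge : ∀ {i S û v̂} → IsComponent (H i) S → Edge∋ i S û v̂ → inΓ û → inΓ v̂ → EdgeΓ û v̂
  gamma-edge {i} {S} K (a , a' , refl , refl , h) x∈ y∈ =
    let x , _ , e = Part.Γ→S i S K (a , refl) x∈
        y , _ , e' = Part.Γ→S i S K (a' , refl) y∈
        P = Part.place-pos i S K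
    in x , y , e , e' , proj₁ (Part.EE→H i S K (trans e (sym (P a))) (trans e' (sym (P a')))
         (Part.E→EE i S K (subst₂ (E (TK i S)) (sym (Part.strictlyInverseʳ i S K a)) (sym (Part.strictlyInverseʳ i S K a')) h)))

  on-Γ : ∀ {i S i' S' û} → IsComponent (H i) S → IsComponent (H i') S' → (i , S) ≢ (i' , S') → inTK i S û → inTK i' S' û → inK S û × inK S' û
  on-Γ {i} {S} {i'} {S'} {û} K K' n a b = Equivalence.to (TK∩TK i S i' S' K K' (λ { (refl , refl) → n refl }) û) (a , b)

  toΓ : ∀ {S û} → inK S û → inΓ û
  toΓ (x , _ , e) = x , e

  module Local (i : Fin 3) (S : Subset n) (K : IsComponent (H i) S) where
    open Part i S K

    -- An edge of a different territory has both ends in the intersection of the two, hence in Γ,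
    -- and there it is an edge of Γ.
    local-edge : ∀ {û v̂ u v} → place u ≡ û → place v ≡ v̂ → EG û v̂ → EE u v ⊎ EdgeΓ û v̂
    local-edge _ _ (inj₁ h) = inj₂ h
    local-edge {u = u} {v} refl refl (inj₂ (i' , S' , K' , a , a' , e , e' , h)) with (i , S) ≟K (i' , S')
    ... | yes refl = inj₁ (E→EE (subst₂ (E (TK i S)) (ι-inj i S e) (ι-inj i S e') h))
    ... | no n = inj₂ (gamma-edge K' (a , a' , e , e' , h)
        (toΓ (proj₁ (on-Γ K K' n (in-part u) (a , e)))) (toΓ (proj₁ (on-Γ K K' n (in-part v) (a' , e')))))

    -- A Γ-edge between near vertices of the part has a colour occurring in the short path between them.
    induced : ∀ {u v} → Within EE (2 * t) u v → EG (place u) (place v) → EE u v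
    induced {u} {v} w h with local-edge {u = u} {v} refl refl h
    ... | inj₁ h' = h'
    ... | inj₂ (x , y , e , e' , xy) with colour xy
    ...   | c , refl = H→EE e e' (mate→H (c , c≢i , refl))
      where
      module P = Path (close e e' w)
      word≡ : P.word ≡ c ∷ []
      word≡ = word-unique P.word (c ∷ []) {x} P.reduced (tt , tt) P.ends
        (≤-<-trans (+-mono-≤ P.short (≤-trans ≤-refl 0<D)) (<-trans (n<1+n _) 2D<g))
      c≢i : c ≢ i
      c≢i with subst (All (_≢ i)) word≡ P.avoids
      ... | q ∷ _ = q

    good : ∀ {u v} → X.Good u v → HasInducedCycle (DeleteEdge EG (place u) (place v)) (4 + (s + s))
    good {u} {v} (f , F@(inj , adj)) = place ∘ f , inj ∘ place-inj , λ a b → mk⇔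
      (λ (h , k) → Equivalence.to (adj a b) (induced (near a b) h , k ∘ Sum.map (λ (p , q) → cong place p , cong place q) (λ (p , q) → cong place p , cong place q)))
      (λ c → let h , k = Equivalence.from (adj a b) c in
             EE→EG h , k ∘ Sum.map (λ (p , q) → place-inj p , place-inj q) (λ (p , q) → place-inj p , place-inj q))
      where
      near : ∀ a b → Within EE (2 * t) (f a) (f b)
      near a b = within-≤ (≤-trans (n≤1+n _) (≤-trans (n≤1+n _) (≤-reflexive (cong (5 +_) (sym (flap-length r))))))
        (within-map proj₁ (cycle-within {R = DeleteEdge EE u v} (Delete-sym {R = EE} Sum.swap) {f = f} F a b))

    place-face : ∀ {u v û v̂} → place u ≡ û → place v ≡ v̂ → Face EE t u v → Face EG t û v̂
    place-face e e' (f , F@(inj , adj) , (a , p) , (b , q)) = place ∘ f , (inj ∘ place-inj , λ a b → mk⇔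
      (λ h → Equivalence.to (adj a b) (induced (within-≤ (m≤m+n t _) (cycle-within {R = EE} Sum.swap {f = f} F a b)) h))
      (EE→EG ∘ Equivalence.from (adj a b))) , (a , trans (cong place p) e) , (b , trans (cong place q) e')

  EG-sym : Sym EG
  EG-sym (inj₁ (x , y , e , e' , h)) = inj₁ (y , x , e' , e , proj₁ simpleΓ h)
  EG-sym (inj₂ (i , S , K , a , a' , e , e' , h)) = inj₂ (i , S , K , a' , a , e' , e
    , Equivalence.from (φE a' a) (Sum.swap (Equivalence.to (φE a a') h)))
    where φE = proj₁ (proj₂ (proj₂ (proj₂ (TK-canon i S K))))

  module Meeting (x : Fin n) {i j c : Fin 3} (i≢j : i ≢ j) (c≢i : c ≢ i) (c≢j : c ≢ j) {S S' : Subset n}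
                 (K : IsComponent (H i) S) (K' : IsComponent (H j) S') where
    private
      module A where
        open Part i S K public
        open Local i S K public
      module B where
        open Part j S' K' public
        open Local j S' K' public
      y : Fin n
      y = mate c x
      K≢K' : (i , S) ≢ (j , S')
      K≢K' refl = i≢j refl

    NotEnd : U → Set
    NotEnd û = û ≢ ιΓ x × û ≢ ιΓ y

    not-end : ∀ {û x'} → NotEnd û → ιΓ x' ≡ û → ¬ (x' ≡ x ⊎ x' ≡ y)
    not-end (n , _) refl (inj₁ e) = n (cong ιΓ e)
    not-end (_ , n) refl (inj₂ e) = n (cong ιΓ e)

    meet : ∀ {u₀ v₀ u v} → ιΓ x ≡ A.place u₀ → ιΓ x ≡ B.place v₀ →
           Within A.EE (2 * t) u u₀ → Within B.EE (2 * t) v v₀ → NotEnd (A.place u) → A.place u ≢ B.place v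
    meet {u = u} {v} e e' w w' n q with on-Γ K K' K≢K' (A.in-part u) (B.vertex v , sym q)
    ... | (x' , _ , p) , _ = not-end n p (two-paths i≢j c≢i c≢j (A.close p e w) (B.close (trans p q) e' w') (<-trans (n<1+n _) 2D<g))

    -- An edge of either territory puts its far end into both, and `meet` excludes this after
    -- lengthening one walk by that edge, which the margin between t and 2t permits. An edge of Γ or
    -- of a third territory joins two vertices of Γ and is excluded by `two-paths-edge`.
    apart : ∀ {u₀ v₀ u v} → ιΓ x ≡ A.place u₀ → ιΓ x ≡ B.place v₀ →
            Within A.EE t u u₀ → Within B.EE t v v₀ → NotEnd (A.place u) → NotEnd (B.place v) →
            A.place u ≢ B.place v × ¬ EG (A.place u) (B.place v)
    apart {u₀} {v₀} {u} {v} e e' w w' n n' = meet e e' (wide w) (wide w') n , no-edge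
      where
      wide : ∀ {V : Set} {R : Rel V} {a b} → Within R t a b → Within R (2 * t) a b
      wide = within-≤ (m≤m+n t _)
      step : ∀ {V : Set} {R : Rel V} {a b c} → R b a → Within R t b c → Sym R → Within R (2 * t) a c
      step h w sy = within-≤ (+-mono-≤ (s≤s {0} {4 + r} z≤n) (≤-reflexive (sym (+-identityʳ t)))) (move (sy h) w)
      no-Γ : ¬ EdgeΓ (A.place u) (B.place v)
      no-Γ (x₁ , x₂ , p , q , h) =
        [ not-end n p , not-end n' q ]′ (two-paths-edge i≢j c≢i c≢j (A.close p e (wide w)) (B.close q e' (wide w')) h 2D<g)
      no-edge : ¬ EG (A.place u) (B.place v)
      no-edge (inj₁ h) = no-Γ h
      no-edge (inj₂ (i'' , S'' , K'' , a , a' , p , q , h)) with (i , S) ≟K (i'' , S'') | (j , S') ≟K (i'' , S'')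
      ... | yes refl | _ = meet {u = A.pos a'} {v} e e'
              (step {R = A.EE} (A.E→EE (subst₂ (E (TK i S)) (ι-inj i S p) (sym (A.strictlyInverseʳ a')) h)) w Sum.swap) (wide w')
              (subst NotEnd (sym a'≡) n') a'≡
        where
        a'≡ : A.place (A.pos a') ≡ B.place v
        a'≡ = trans (A.place-pos a') q
      ... | no _ | yes refl = meet {u = u} {B.pos a} e e' (wide w)
              (step {R = B.EE} (B.E→EE (subst₂ (E (TK j S')) (ι-inj j S' q) (sym (B.strictlyInverseʳ a)) (sym-E h))) w' Sum.swap)
              n (sym (trans (B.place-pos a) p))
        where
        φE = proj₁ (proj₂ (proj₂ (proj₂ (TK-canon j S' K'))))
        sym-E : ∀ {a a'} → E (TK j S') a a' → E (TK j S') a' a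
        sym-E h = Equivalence.from (φE _ _) (Sum.swap (Equivalence.to (φE _ _) h))
      ... | no m | no m' = no-Γ (gamma-edge K'' (a , a' , p , q , h) (toΓ (proj₁ (on-Γ K K'' m (A.in-part u) (a , p))))
              (toΓ (proj₁ (on-Γ K' K'' m' (B.in-part v) (a' , q)))))

  Result : U → U → Set
  Result û v̂ = HasInducedCycle (DeleteEdge EG û v̂) (4 + (s + s))

  module AtEnd (x : Fin n) (c i : Fin 3) (c≢i : c ≢ i) where
    private
      y = mate c x
      S = proj₁ (componentH i x)
      x∈S = proj₁ (proj₂ (componentH i x))
    K : IsComponent (H i) S
    K = proj₂ (proj₂ (componentH i x))
    open Part i S K public
    open Local i S K public
    private
      Hxy : H i x y
      Hxy = mate→H (c , c≢i , refl)
    px py : ∃ λ v → place v ≡ ιΓ _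
    px = pos-of (S→TK (x , x∈S , refl))
    py = pos-of (S→TK (y , proj₁ (proj₂ K) x y x∈S Hxy , refl))
    atEdge : Result (ιΓ x) (ιΓ y) ⊎ Face EE t (proj₁ px) (proj₁ py)
    atEdge = Sum.map (subst₂ Result (proj₂ px) (proj₂ py) ∘ good) (λ (_ , _ , f) → f)
      (X.outcome (H→EE (sym (proj₂ px)) (sym (proj₂ py)) Hxy))

  Γ-edge : ∀ {x y} → EΓ x y → Result (ιΓ x) (ιΓ y)
  Γ-edge {x} h with colour h
  ... | c , refl with other-colours c
  ...   | i , j , i≢j , c≢i , c≢j = join A.atEdge B.atEdge
    where
    module A = AtEnd x c i c≢i
    module B = AtEnd x c j c≢j
    join : Result (ιΓ x) (ιΓ (mate c x)) ⊎ Face A.EE t (proj₁ A.px) (proj₁ A.py) →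
           Result (ιΓ x) (ιΓ (mate c x)) ⊎ Face B.EE t (proj₁ B.px) (proj₁ B.py) → Result (ιΓ x) (ιΓ (mate c x))
    -- A cycle found inside one territory is already enough, since `good` has carried it over to
    -- `EG`.
    join (inj₁ g) _ = g
    join (inj₂ _) (inj₁ g) = g
    join (inj₂ F@(f , FC , (a₀ , fa) , _)) (inj₂ G@(f' , GC , (b₀ , gb) , _)) =
      merge {R = EG} EG-sym (inj₁ (x , mate c x , refl , refl , h))
        (A.place-face (proj₂ A.px) (proj₂ A.py) F) (B.place-face (proj₂ B.px) (proj₂ B.py) G)
        λ a b n₁ n₂ n₃ n₄ → apart {f a₀} {f' b₀} {f a} {f' b}
          (trans (sym (proj₂ A.px)) (cong A.place (sym fa))) (trans (sym (proj₂ B.px)) (cong B.place (sym gb)))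
          (cycle-within {R = A.EE} Sum.swap {f = f} FC a a₀) (cycle-within {R = B.EE} Sum.swap {f = f'} GC b b₀) (n₁ , n₂) (n₃ , n₄)
      where open Meeting x i≢j c≢i c≢j A.K B.K

  any-edge : ∀ û v̂ → EG û v̂ → Result û v̂
  any-edge _ _ (inj₁ (x , y , refl , refl , h)) = Γ-edge h
  any-edge _ _ (inj₂ (i , S , K , a , a' , refl , refl , h)) =
    [ subst₂ Result (place-pos a) (place-pos a') ∘ good , boundary ]′ (X.outcome a∼a')
    where
    open Part i S K
    open Local i S K
    a∼a' : EE (pos a) (pos a')
    a∼a' = E→EE (subst₂ (E (TK i S)) (sym (strictlyInverseʳ a)) (sym (strictlyInverseʳ a')) h)
    boundary : inB (pos a) × inB (pos a') × Face EE t (pos a) (pos a') → Result (ι i S a) (ι i S a')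
    boundary (b , b' , _) =
      let x , _ , e = inB→S b
          y , _ , e' = inB→S b'
      in subst₂ Result (trans e (place-pos a)) (trans e' (place-pos a')) (Γ-edge (proj₁ (EE→H e e' a∼a')))

theorem4p5 : (t : ℕ) → 5 ≤ t → (C : Construction t) →
    let open Construction C in
    ∀ u v → EG u v → HasInducedCycle (DeleteEdge EG u v) (2 * t ∸ 2)
theorem4p5 (suc (suc (suc (suc (suc r))))) (s≤s (s≤s (s≤s (s≤s (s≤s z≤n))))) C u v h =
  -- The length is matched through 2t - 2 = 3 + (2t - 5), where 2t - 5 = 2s + 1 is the number of
  -- vertices of a flap path.
  subst (HasInducedCycle (DeleteEdge (Construction.EG C) u v)) (cong (3 +_) (sym (flap-length r)))
    (Proof.any-edge r C _ (Construction.girth C) (spread r (2 * (5 + r))) ≤-refl (spread>0 r _) (spread<girth r) u v h)
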